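{- Let $n\geq 1$, let $M$ be a rooted triangulation with $n+3$ vertices endowed with its minimal Schnyder wood, let $(\gamma,\gamma')\in\mathcal{I}_n$ be its image under the Bernardi–Bonichon map, and let $T\in\mathcal{T}_n$ be its 3-mobile. Then there is a bijection from the set of positions $\{0,1,\ldots,n\}$ to the set of black nodes of $T$ whose blue edge is a leg, such that each position $r$ is mapped to a black node of the same type.
   Context: Triangulations and Schnyder woods: a rooted triangulation is a simple planar map with all faces of degree $3$ and a marked corner in the outer face; its outer vertices are $u_B,u_G,u_R$ in clockwise order, $u_B$ being the root vertex. A Schnyder wood is an orientation and coloring (blue, green, red) of the inner edges such that all inner edges at $u_B$ (resp. $u_G$, $u_R$) are ingoing blue (resp. green, red), and every inner vertex has exactly one outgoing edge of each color, the edges around it being in clockwise order: outgoing blue, ingoing reds, outgoing green, ingoing blues, outgoing red, ingoing greens (groups possibly empty). Corners are colored: a corner at an inner vertex gets the color $c$ such that the corner lies in the sector delimited by the two outgoing edges of the colors other than $c$; a corner at an outer vertex gets the color of that vertex. A Schnyder wood is minimal if it has no clockwise directed cycle; each rooted triangulation has a unique minimal Schnyder wood. Tamari intervals: walks are words on $\{N,E\}$ seen as lattice paths from the origin ($N=(0,1)$, $E=(1,0)$); $\gamma'$ is above $\gamma$ if same endpoint and no East step of $\gamma$ is strictly above the East step of $\gamma'$ in the same column. A Dyck walk of length $2n$ is a walk above $(NE)^n$. For $\nu=(NE)^n$, and $\gamma$ a Dyck walk with point $p=(x,y)$, set $\ell(p)=x'-x$ where $x'$ is the abscissa of the North step of $\nu$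 from ordinate $y$ to $y+1$ ($x'=n$ if $y=n$); if $p$ is preceded by $E$ and followed by $N$, let $p'$ be the next point after $p$ with $\ell(p')=\ell(p)$ and $\mathrm{push}_p(\gamma)$ obtained by moving the $E$ before $p$ to just after $p'$. The Tamari lattice $\mathrm{Tam}_n$ is the set of Dyck walks of length $2n$ ordered by the reflexive-transitive closure of $\gamma\leq\mathrm{push}_p(\gamma)$; $\mathcal{I}_n$ is the set of pairs $(\gamma,\gamma')$ with $\gamma\leq\gamma'$ in $\mathrm{Tam}_n$. For a Dyck walk $\gamma=E^{\alpha_0}NE^{\alpha_1}\cdots NE^{\alpha_n}$, its canopy-word is $\mathrm{can}(\gamma)=(w_0,\ldots,w_n)$ with $w_r=E$ if $\alpha_r=0$ and $w_r=N$ if $\alpha_r\geq 1$. For $(\gamma,\gamma')\in\mathcal{I}_n$, a position $r\in\{0,\ldots,n\}$ has type $\binom{d}{c}$ if $\mathrm{can}(\gamma)$ has letter $c$ and $\mathrm{can}(\gamma')$ has letter $d$ at position $r$; the possible types are $\binom{N}{N},\binom{E}{N},\binom{E}{E}$. Bernardi–Bonichon map: given $M$ with $n+3$ vertices and a Schnyder wood, let $T_{\mathrm{blue}}$ be the blue tree (blue edges) plus the outer edge $\{u_B,u_R\}$, a tree rooted at $u_B$; let $v_0,\ldots,v_n$ (with $v_n=u_R$) be the vertices of $T_{\mathrm{blue}}$ other than $u_B$ in order of first visit in a clockwise walk around $T_{\mathrm{blue}}$ from $u_B$. Then $\gamma$ is the contour walk of $T_{\mathrm{blue}}$ minus the edge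 $\{u_B,u_R\}$ (writing $N$ when moving away from $u_B$ and $E$ when moving towards it, in a clockwise walk), and $\gamma'=NE^{\beta_1}NE^{\beta_2}\cdots NE^{\beta_n}$ with $\beta_r$ the number of ingoing red edges at $v_r$. Restricted to minimal Schnyder woods this is a bijection onto $\mathcal{I}_n$. 3-mobiles: a 3-mobile is an unrooted plane tree whose vertices have degree $1$ (leaves) or $3$ (nodes), nodes colored black or white with adjacent nodes of different colors, every leaf adjacent to a black node, at least one white node, and edges colored blue, green, red so that around each node the incident edges in clockwise order are blue, green, red. An edge incident to a leaf is a leg. $\mathcal{T}_n$ is the set of 3-mobiles with $n$ white nodes. The 3-mobile of $M$ (with its minimal Schnyder wood): orient the outer cycle clockwise, put a black node $b_f$ in each inner face $f$; for each edge $e=u\to v$ with left face $f$ and right face $f'$, create an edge $\{u,b_f\}$ if $f$ is an inner face, colored as the corner of $u$ in $f$, and create a leg at $b_{f'}$ pointing towards $v$, colored as the corner of $v$ in $f'$; then erase the outer vertices (with their incident new edges) and all edges of $M$; the inner vertices of $M$ are the white nodes. A black node whose blue edge is a leg has type $\binom{N}{N}$ if its red edge is also a leg, type $\binom{E}{E}$ if its green edge is also a leg, and type $\binom{E}{N}$ otherwise. -}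

module Defs where

open import Data.Nat using (ℕ; zero; suc; _+_; _*_; _≤_; _<_; _≤?_)
open import Data.Fin using (Fin; toℕ; fromℕ) renaming (zero to fzero; _≟_ to _≟F_)
open import Data.Fin.Properties using (any?; all?)
open import Data.Bool using (Bool; true; false; not; if_then_else_)
open import Data.Bool.Properties using () renaming (_≟_ to _≟B_)
open import Data.List using (List; []; _∷_; map; length; filter; filterᵇ; upTo; concatMap; replicate; drop; _++_)
open import Data.List.Base using (head)
open import Data.Fin.Base using () renaming (zero to fz)
open import Data.Maybe using (Maybe; just; nothing)
open import Data.Product using (Σ; _×_; _,_; ∃)
open import Data.Sum using (_⊎_)
open import Data.Empty using (⊥)
open import Relation.Nullary using (¬_; Dec; yes; no)
open import Relation.Nullary.Decidable using (_×-dec_; _⊎-dec_; ¬?)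
open import Relation.Binary.PropositionalEquality using (_≡_; _≢_)
open import Relation.Binary.Construct.Closure.ReflexiveTransitive using (Star)
open import Function.Definitions using (Injective)

iter : {A : Set} → (A → A) → ℕ → A → A
iter f zero    x = x
iter f (suc i) x = f (iter f i x)

headOr : {A : Set} → A → List A → A
headOr d []      = d
headOr d (x ∷ _) = x

data Colour : Set where
  blue green red : Colour

_≟C_ : (a b : Colour) → Dec (a ≡ b)
blue  ≟C blue  = yes _≡_.refl
blue  ≟C green = no λ ()
blue  ≟C red   = no λ ()
green ≟C blue  = no λ ()
green ≟C green = yes _≡_.refl
green ≟C red   = no λ ()
red   ≟C blue  = no λ ()
red   ≟C green = no λ ()
red   ≟C red   = yes _≡_.refl

-- colour of a corner at an inner vertex, given the colour of the first
-- outgoing edge met clockwise after the corner: the sector from outgoing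
-- blue to outgoing green is red, from green to red is blue, from red to
-- blue is green.
sectorColour : Colour → Colour
sectorColour green = red
sectorColour red   = blue
sectorColour blue  = green

data Letter : Set where
  N E : Letter

-- Canopy words.  For  γ = E^{α₀} N E^{α₁} ⋯ N E^{αₙ}  we compute the list
-- (α₀, …, αₙ) and then can(γ) = (w₀, …, wₙ) with wᵣ = E iff αᵣ = 0.

incHead : List ℕ → List ℕ
incHead []       = []
incHead (a ∷ as) = suc a ∷ as

exponents : List Letter → List ℕ
exponents []      = 0 ∷ []
exponents (E ∷ w) = incHead (exponents w)
exponents (N ∷ w) = 0 ∷ exponents w

canLetter : ℕ → Letter
canLetter zero    = E
canLetter (suc _) = N

can : List Letter → List Letter
can w = map canLetter (exponents w)

-- r-th letter of a word (the default is never used on words of the right length)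
nth : List Letter → ℕ → Letter
nth []      _       = E
nth (x ∷ _) zero    = x
nth (_ ∷ w) (suc r) = nth w r

-- the type  (d over c)  is encoded as the pair (d , c)
Type : Set
Type = Letter × Letter

positionType : List Letter → List Letter → ℕ → Type
positionType γ γ' r = nth (can γ') r , nth (can γ) r

-- Combinatorial maps.  Darts are Fin k;  α = opposite dart,  σ = next dart
-- in CLOCKWISE order around its vertex.  The corner κ(d) is the sector at
-- the vertex of d going clockwise from d to σ d; it lies in the face on the
-- right of d.  Faces are the orbits of φ = α ∘ σ (acting on corners).
-- ρ is the root dart: the root corner is κ(ρ), in the outer face.

record Map (k : ℕ) : Set where
  field
    α σ : Fin k → Fin k
    ρ   : Fin k

module MapOps {k : ℕ} (M : Map k) where
  open Map M public

  φ : Fin k → Fin k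
  φ d = α (σ d)

  -- same vertex / same face (orbits of σ / φ; an orbit has at most k elements)
  SameVertex : Fin k → Fin k → Set
  SameVertex x y = Σ (Fin k) λ i → iter σ (toℕ i) x ≡ y

  sameVertex? : (x y : Fin k) → Dec (SameVertex x y)
  sameVertex? x y = any? (λ i → iter σ (toℕ i) x ≟F y)

  SameFace : Fin k → Fin k → Set
  SameFace x y = Σ (Fin k) λ i → iter φ (toℕ i) x ≡ y

  IsOrbitMin : (Fin k → Fin k) → Fin k → Set
  IsOrbitMin π d = (i : Fin k) → toℕ d ≤ toℕ (iter π (toℕ i) d)

  isOrbitMin? : (π : Fin k → Fin k) → (d : Fin k) → Dec (IsOrbitMin π d)
  isOrbitMin? π d = all? (λ i → toℕ d ≤? toℕ (iter π (toℕ i) d))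

  numOrbits : (Fin k → Fin k) → ℕ
  numOrbits π = length (filter (isOrbitMin? π) (Data.List.allFin k))
    where import Data.List

  numVertices numEdges numFaces : ℕ
  numVertices = numOrbits σ
  numEdges    = numOrbits α
  numFaces    = numOrbits φ

  -- outer vertices: u_B = v(ρ), u_G = v(φ ρ), u_R = v(φ² ρ)  (clockwise)
  dB dG dR : Fin k
  dB = ρ
  dG = φ ρ
  dR = φ (φ ρ)

  -- tail darts of the three outer edges oriented clockwise
  -- (u_B → u_G, u_G → u_R, u_R → u_B)
  OuterTail : Fin k → Set
  OuterTail y = (y ≡ σ dB) ⊎ (y ≡ σ dG) ⊎ (y ≡ σ dR)

  outerTail? : (y : Fin k) → Dec (OuterTail y)
  outerTail? y = (y ≟F σ dB) ⊎-dec (y ≟F σ dG) ⊎-dec (y ≟F σ dR)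

  OuterDart : Fin k → Set
  OuterDart y = OuterTail y ⊎ OuterTail (α y)

  outerDart? : (y : Fin k) → Dec (OuterDart y)
  outerDart? y = outerTail? y ⊎-dec outerTail? (α y)

  InnerVertex : Fin k → Set
  InnerVertex y = ¬ SameVertex y dB × ¬ SameVertex y dG × ¬ SameVertex y dR

  InnerFace : Fin k → Set
  InnerFace f = ¬ SameFace ρ f

  Adj : Fin k → Fin k → Set
  Adj d d' = (d' ≡ σ d) ⊎ (d' ≡ α d)

record IsRootedTriangulation {k : ℕ} (M : Map k) : Set where
  open MapOps M
  field
    α-invol     : ∀ d → α (α d) ≡ d
    α-fixfree   : ∀ d → α d ≢ d
    σ-perm      : Injective _≡_ _≡_ σ
    connected   : ∀ d d' → Star Adj d d'
    planar      : numVertices + numFaces ≡ numEdges + 2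
    triangular  : ∀ d → φ (φ (φ d)) ≡ d × φ d ≢ d
    no-loop     : ∀ d → ¬ SameVertex d (α d)
    no-multi    : ∀ d d' → SameVertex d d' → SameVertex (α d) (α d') → d ≡ d'

-- Orientation + colouring of edges (only meaningful on inner edges):
-- col d = colour of the edge of d,  out d = true iff the edge is oriented
-- away from the vertex of d.

record Wood (k : ℕ) : Set where
  field
    col : Fin k → Colour
    out : Fin k → Bool

module WoodOps {k : ℕ} (M : Map k) (W : Wood k) where
  open MapOps M public
  open Wood W public

  Lab : Fin k → Bool × Colour
  Lab y = out y , col y

  LocalRule : Fin k → Set
  LocalRule y =
    Σ (Fin k) λ d → SameVertex y d × Σ ℕ λ a → Σ ℕ λ b → Σ ℕ λ c →
        (Lab d ≡ (true , blue))
      × (∀ i → 1 ≤ i → i ≤ a → Lab (iter σ i d) ≡ (false , red))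
      × (Lab (iter σ (a + 1) d) ≡ (true , green))
      × (∀ i → 1 ≤ i → i ≤ b → Lab (iter σ (a + 1 + i) d) ≡ (false , blue))
      × (Lab (iter σ (a + b + 2) d) ≡ (true , red))
      × (∀ i → 1 ≤ i → i ≤ c → Lab (iter σ (a + b + 2 + i) d) ≡ (false , green))
      × (iter σ (a + b + c + 3) d ≡ d)
      × (∀ j → 1 ≤ j → j < a + b + c + 3 → iter σ j d ≢ d)

  record IsSchnyderWood : Set where
    field
      inner-edge : ∀ y → ¬ OuterDart y → col (α y) ≡ col y × out (α y) ≡ not (out y)
      at-uB      : ∀ y → ¬ OuterDart y → SameVertex dB y → Lab y ≡ (false , blue)
      at-uG      : ∀ y → ¬ OuterDart y → SameVertex dG y → Lab y ≡ (false , green)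
      at-uR      : ∀ y → ¬ OuterDart y → SameVertex dR y → Lab y ≡ (false , red)
      local      : ∀ y → InnerVertex y → LocalRule y

  IsDirectedCycle : {m : ℕ} → (Fin (suc m) → Fin k) → Set
  IsDirectedCycle {m} cyc =
      (∀ i → ¬ OuterDart (cyc i) × out (cyc i) ≡ true)
    × (∀ i j → toℕ j ≡ suc (toℕ i) → SameVertex (α (cyc i)) (cyc j))
    × SameVertex (α (cyc (fromℕ m))) (cyc fzero)
    × (∀ i j → SameVertex (cyc i) (cyc j) → i ≡ j)

  OnCycle : {m : ℕ} → (Fin (suc m) → Fin k) → Fin k → Set
  OnCycle {m} cyc x = Σ (Fin (suc m)) λ i → (x ≡ cyc i) ⊎ (x ≡ α (cyc i))

  -- moving between corners without crossing the cycle: stay in the face,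
  -- or cross the edge of x (κ(x) ↦ κ(α x)) if it is not on the cycle
  CornerStep : {m : ℕ} → (Fin (suc m) → Fin k) → Fin k → Fin k → Set
  CornerStep cyc x y = (y ≡ φ x) ⊎ ((y ≡ α x) × ¬ OnCycle cyc x)

  -- a cycle is clockwise iff the region on its right (containing the corner
  -- κ(d₀), which lies in the face on the right of d₀) is bounded, i.e. does
  -- not contain the outer face
  Clockwise : {m : ℕ} → (Fin (suc m) → Fin k) → Set
  Clockwise cyc = ¬ Star (CornerStep cyc) (cyc fzero) ρ

  IsMinimal : Set
  IsMinimal = ∀ (m : ℕ) (cyc : Fin (suc m) → Fin k) → IsDirectedCycle cyc → ¬ Clockwise cyc

  -- corner colours: the corner κ(x) lies between x and σ x

  CornerColour : Fin k → Colour → Set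
  CornerColour x c =
      (SameVertex x dB × c ≡ blue)
    ⊎ (SameVertex x dG × c ≡ green)
    ⊎ (SameVertex x dR × c ≡ red)
    ⊎ (InnerVertex x × Σ ℕ λ j → 1 ≤ j × out (iter σ j x) ≡ true
         × (∀ i → 1 ≤ i → i < j → out (iter σ i x) ≡ false)
         × c ≡ sectorColour (col (iter σ j x)))

  -- the 3-mobile: the edge of y, oriented away from v(y) (outer edges
  -- oriented clockwise), creates a leg at b_{f'} for f' the face on the right
  -- of y (containing κ(y)), coloured as the corner of v(α y) in f'.

  Oriented : Fin k → Set
  Oriented y = OuterTail y ⊎ (¬ OuterDart y × out y ≡ true)

  LegAt : Fin k → Colour → Set
  LegAt f c = Σ (Fin k) λ y → Oriented y × SameFace y f ×
                Σ (Fin k) λ x → SameFace x f × SameVertex x (α y) × CornerColour x c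

  BlackType : Fin k → Type → Set
  BlackType f t =
      (LegAt f red × t ≡ (N , N))
    ⊎ (¬ LegAt f red × LegAt f green × t ≡ (E , E))
    ⊎ (¬ LegAt f red × ¬ LegAt f green × t ≡ (E , N))

  -- Bernardi–Bonichon: T_blue = inner blue edges + the outer edge {u_B,u_R}
  -- (the edge of ρ).

  TreeDart : Fin k → Set
  TreeDart y = (¬ OuterDart y × col y ≡ blue) ⊎ (y ≡ ρ) ⊎ (y ≡ α ρ)

  treeDart? : (y : Fin k) → Dec (TreeDart y)
  treeDart? y = (¬? (outerDart? y) ×-dec (col y ≟C blue)) ⊎-dec (y ≟F ρ) ⊎-dec (y ≟F α ρ)

  firstTree : Fin k → Fin k
  firstTree x = headOr x (filter treeDart? (map (λ j → iter σ j x) (upTo k)))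

  -- clockwise contour walk of T_blue from the root corner at u_B:
  -- s steps, each step leaves along the first tree dart clockwise after
  -- the dart by which the current vertex was entered
  contourFrom : ℕ → Fin k → List (Fin k)
  contourFrom zero    x = []
  contourFrom (suc s) x = firstTree x ∷ contourFrom s (σ (α (firstTree x)))

  -- the first 2n steps (the walk around T_blue minus the edge {u_B,u_R})
  contour : ℕ → List (Fin k)
  contour n = contourFrom (2 * n) (σ ρ)

  -- N when moving away from u_B (edge oriented towards v(e)), E otherwise
  letter : Fin k → Letter
  letter e = if out e then E else N

  γ : ℕ → List Letter
  γ n = map letter (contour n)

  -- darts at v₀, …, v_{n-1} (first visits = targets of N steps), then v_n = u_R
  visitDarts : ℕ → List (Fin k)
  visitDarts n = map α (filterᵇ (λ e → not (out e)) (contour n)) ++ (α ρ ∷ [])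

  InRed : Fin k → Fin k → Set
  InRed x y = SameVertex x y × ¬ OuterDart y × col y ≡ red × out y ≡ false

  inRed : Fin k → ℕ
  inRed x = length (filter (λ y → sameVertex? x y ×-dec ¬? (outerDart? y)
                                   ×-dec (col y ≟C red) ×-dec (out y ≟B false))
                           (Data.List.allFin k))
    where import Data.List

  γ' : ℕ → List Letter
  γ' n = concatMap (λ x → N ∷ replicate (inRed x) E) (drop 1 (visitDarts n))

  TypeBijection : ℕ → Set
  TypeBijection n =
    Σ (Fin (suc n) → Fin k) λ g →
        (∀ r → InnerFace (g r) × LegAt (g r) blue
                × BlackType (g r) (positionType (γ n) (γ' n) (toℕ r)))
      × (∀ r r' → SameFace (g r) (g r') → r ≡ r')
      × (∀ f → InnerFace f → LegAt f blue → Σ (Fin (suc n)) λ r → SameFace (g r) f)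

{-# OPTIONS --safe #-}
module Submission where

-- A black node has a blue leg exactly when its face lies to the right of the out-blue dart y of
-- some v_r, or of the dart from u_R to u_B; call it the face of v_r.  The corners of that face at
-- y, φ y and φ (φ y) are red, green and blue.  Its red edge is a leg iff v_r has an ingoing red
-- edge, and otherwise its green edge is a leg iff v_r is the first child of its parent, that is,
-- r = 0 or v_{r-1} is not a leaf of T_blue.  Minimality enters only through this face: if v_r is
-- the first child of v_{r-1} and has an ingoing red edge, then the face is bounded by a clockwise
-- cycle.
--
-- That the contour walk visits every vertex is shown without Euler's formula.  Let π be the walk
-- that turns around a vertex and follows the edges of T_blue and {u_B , u_G}.  Seen in the dual map,
-- it follows the edges outside this subgraph.  In both maps the component of the root is a rooted
-- tree, whose corners therefore form a single orbit of π.  So the orbit of the root corner is a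
-- union of vertices and a union of faces, and by connectedness it contains every corner.

-- Nothing in the definition of a Schnyder wood says that the blue edges are acyclic: each inner
-- vertex has one parent, but a chain of parents might close up away from the root, where the
-- contour walk would miss it. Acyclicity is therefore never a premise: only darts whose chain of
-- parents ends at the root get a `Depth`, and that the walk covers everything is a conclusion. The
-- edge {u_B , u_G} is added because u_G meets no blue edge. With it every vertex except u_B has
-- exactly one dart of `Up`, and no face has two darts of `Exit`. The length 2n of the contour comes
-- from a count: n + 3 vertices give n + 2 darts of `Up`, hence 2n + 4 darts of `Tree`; two belong
-- to {u_B , u_G} and two to {u_B , u_R}. The local arguments rest on one rule: around an inner
-- face, `φ` advances the corner colour by `next`. A face is thus named by its red corner, and
-- whether the mobile edge at a corner is a leg depends on the orientation of a single dart.

open import Defs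
open import Data.Bool using (Bool; true; false; not; if_then_else_; T)
open import Data.Bool.Properties using (T?) renaming (_≟_ to _≟B_)
open import Data.Empty using (⊥; ⊥-elim)
open import Data.Fin using (Fin; toℕ; fromℕ<; cast) renaming (_≟_ to _≟F_)
open import Data.Fin.Properties using (any?; pigeonhole; toℕ<n; toℕ-fromℕ<; toℕ-cast; toℕ-injective; injective⇒≤)
open import Data.List using (List; []; _∷_; _++_; length; lookup; map; filter; filterᵇ; applyUpTo; allFin; concatMap; replicate; drop; initLast; _∷ʳ′_)
open import Data.List.Membership.Propositional using (_∈_)
open import Data.List.Membership.Propositional.Properties
open import Data.List.Properties using (length-++; length-map; length-applyUpTo; filter-++; ++-assoc; ∷-injective)
open import Data.List.Relation.Unary.All as All using ()
open import Data.List.Relation.Unary.AllPairs using ([]; _∷_)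
open import Data.List.Relation.Unary.Any using (here; there; index)
open import Data.List.Relation.Unary.Any.Properties using (lookup-index)
open import Data.List.Relation.Unary.Unique.Propositional using (Unique)
import Data.List.Relation.Unary.Unique.Propositional.Properties as Unique
open import Data.Nat using (ℕ; zero; suc; _+_; _*_; _≤_; _<_; z≤n; s≤s; s≤s⁻¹; NonZero; _≤?_; _≟_)
open import Data.Nat.DivMod using (_%_; _/_; m≡m%n+[m/n]*n; m%n<n)
open import Data.Nat.Properties hiding (_≤?_; _≟_)
open import Data.Nat.Tactic.RingSolver using (solve-∀)
open import Data.Product using (Σ; ∃; _×_; _,_; proj₁; proj₂)
open import Data.Sum as Sum using (_⊎_; inj₁; inj₂)
open import Function using (_∘_; id)
open import Function.Definitions using (Injective)
open import Relation.Binary.Construct.Closure.ReflexiveTransitive using (Star; ε; _◅_)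
open import Relation.Binary.Definitions using (tri<; tri≈; tri>)
open import Relation.Binary.PropositionalEquality hiding ([_])
open import Relation.Nullary using (¬_; Dec; yes; no; does)
open import Relation.Nullary.Decidable using (¬?; decidable-stable; dec-true; dec-false)

-- Orbits of a self-map

iter-+ : {A : Set} (f : A → A) (m n : ℕ) (x : A) → iter f (m + n) x ≡ iter f m (iter f n x)
iter-+ f zero    n x = refl
iter-+ f (suc m) n x = cong f (iter-+ f m n x)

iter-shift : {A : Set} (f : A → A) (n : ℕ) (x : A) → iter f n (f x) ≡ iter f (suc n) x
iter-shift f zero    x = refl
iter-shift f (suc n) x = cong f (iter-shift f n x)

iter-*-fixed : {A : Set} (f : A → A) (q p : ℕ) {x : A} → iter f p x ≡ x → iter f (q * p) x ≡ x
iter-*-fixed f zero    p e = refl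
iter-*-fixed f (suc q) p {x} e =
  trans (iter-+ f p (q * p) x) (trans (cong (iter f p) (iter-*-fixed f q p e)) e)

iter-% : {A : Set} (f : A → A) (p : ℕ) .{{_ : NonZero p}} {x : A} → iter f p x ≡ x →
         ∀ m → iter f (m % p) x ≡ iter f m x
iter-% f p {x} e m = begin
  iter f (m % p) x                            ≡⟨ cong (iter f (m % p)) (sym (iter-*-fixed f (m / p) p e)) ⟩
  iter f (m % p) (iter f (m / p * p) x)       ≡⟨ sym (iter-+ f (m % p) (m / p * p) x) ⟩
  iter f (m % p + m / p * p) x                ≡⟨ cong (λ j → iter f j x) (sym (m≡m%n+[m/n]*n m p)) ⟩
  iter f m x                                  ∎
  where open ≡-Reasoning

iter-injective : {A : Set} {f : A → A} → Injective _≡_ _≡_ f → ∀ i → Injective _≡_ _≡_ (iter f i)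
iter-injective inj zero    e = e
iter-injective inj (suc i) e = iter-injective inj i (inj e)

Reaches : {A : Set} → (A → A) → A → A → Set
Reaches f x y = ∃ λ i → iter f i x ≡ y

reaches-refl : {A : Set} {f : A → A} {x : A} → Reaches f x x
reaches-refl = 0 , refl

reaches-step : {A : Set} {f : A → A} {x y : A} → Reaches f x y → Reaches f x (f y)
reaches-step {f = f} (i , e) = suc i , cong f e

reaches-trans : {A : Set} {f : A → A} {x y z : A} → Reaches f x y → Reaches f y z → Reaches f x z
reaches-trans {f = f} {x} (i , refl) (j , e) = j + i , trans (iter-+ f j i x) e

module Orbit {k : ℕ} {f : Fin k → Fin k} (inj : Injective _≡_ _≡_ f) where

  opaque
    -- Two of the first `k + 1` iterates coincide, and injectivity cancels the common prefix. The
    -- bound `k` is what turns unbounded reachability into the bounded search of `SameVertex` and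
    -- `SameFace`.
    period : ∀ x → Σ ℕ λ p → suc p ≤ k × iter f (suc p) x ≡ x
    period x with pigeonhole (n<1+n k) (λ i → iter f (toℕ i) x)
    ... | i , j , i<j , e with m≤n⇒∃[o]m+o≡n i<j
    ...   | o , eo = o , ≤-trans (m≤n+m (suc o) (toℕ i)) (≤-trans (≤-reflexive i+o) (s≤s⁻¹ (toℕ<n j)))
                   , iter-injective inj (toℕ i) (begin
      iter f (toℕ i) (iter f (suc o) x)  ≡⟨ sym (iter-+ f (toℕ i) (suc o) x) ⟩
      iter f (toℕ i + suc o) x           ≡⟨ cong (λ l → iter f l x) i+o ⟩
      iter f (toℕ j) x                   ≡⟨ sym e ⟩
      iter f (toℕ i) x                   ∎)
      where open ≡-Reasoning
            i+o : toℕ i + suc o ≡ toℕ j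
            i+o = trans (+-suc (toℕ i) o) eo

    reaches-bounded : ∀ {x y} → Reaches f x y → Σ (Fin k) λ i → iter f (toℕ i) x ≡ y
    reaches-bounded {x} (m , e) with period x
    ... | p , p≤k , ep = fromℕ< m%p<k , trans (cong (λ l → iter f l x) (toℕ-fromℕ< m%p<k)) (trans (iter-% f (suc p) ep m) e)
      where m%p<k : m % suc p < k
            m%p<k = <-≤-trans (m%n<n m (suc p)) p≤k

    reaches-sym : ∀ {x y} → Reaches f x y → Reaches f y x
    reaches-sym {x} (m , refl) with period x
    -- After `m` steps, `m * p` more complete `m` turns of length `suc p`.
    ... | p , _ , ep = m * p , (begin
      iter f (m * p) (iter f m x) ≡⟨ sym (iter-+ f (m * p) m x) ⟩
      iter f (m * p + m) x        ≡⟨ cong (λ l → iter f l x) (trans (+-comm (m * p) m) (sym (*-suc m p))) ⟩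
      iter f (m * suc p) x        ≡⟨ iter-*-fixed f m (suc p) ep ⟩
      x                           ∎)
      where open ≡-Reasoning

    preimage : ∀ x → Σ (Fin k) λ z → f z ≡ x × Reaches f x z
    preimage x with period x
    ... | p , _ , ep = iter f p x , ep , (p , refl)

least : {P : ℕ → Set} → (∀ i → Dec (P i)) → ∀ m → P m → Σ ℕ λ i → i ≤ m × P i × (∀ j → j < i → ¬ P j)
least P? zero    Pm = 0 , z≤n , Pm , λ _ ()
least P? (suc m) Pm with P? 0
... | yes P0 = 0 , z≤n , P0 , λ _ ()
... | no ¬P0 with least (λ i → P? (suc i)) m Pm
...   | i , i≤m , Pi , lt = suc i , s≤s i≤m , Pi , λ { zero _ → ¬P0 ; (suc j) j<i → lt j (s≤s⁻¹ j<i) }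

lookup-injective : {A : Set} {xs : List A} → Unique xs → ∀ i j → lookup xs i ≡ lookup xs j → i ≡ j
lookup-injective (_ ∷ _) Fin.zero Fin.zero e = refl
lookup-injective (a ∷ _) Fin.zero (Fin.suc j) e = ⊥-elim (All.lookup a (∈-lookup j) e)
lookup-injective (a ∷ _) (Fin.suc i) Fin.zero e = ⊥-elim (All.lookup a (∈-lookup i) (sym e))
lookup-injective (_ ∷ u) (Fin.suc i) (Fin.suc j) e = cong Fin.suc (lookup-injective u i j e)

-- The injection is given as a relation because the vertex count uses it with `SameVertex`, between
-- two different choices of representatives.
length-≤ : {A B : Set} {R : A → B → Set} {xs : List A} {ys : List B} → Unique xs →
           (∀ {x} → x ∈ xs → Σ B λ y → y ∈ ys × R x y) →
           (∀ {x x′ y} → x ∈ xs → x′ ∈ xs → R x y → R x′ y → x ≡ x′) →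
           length xs ≤ length ys
length-≤ {R = R} {xs} {ys} u tot inj = injective⇒≤ {f = f} λ {i} {j} e →
  lookup-injective u i j (inj (∈-lookup i) (∈-lookup j) (rel i) (subst (λ l → R (lookup xs j) (lookup ys l)) (sym e) (rel j)))
  where
  f : Fin (length xs) → Fin (length ys)
  f i = index (proj₁ (proj₂ (tot (∈-lookup i))))
  rel : ∀ i → R (lookup xs i) (lookup ys (f i))
  rel i with tot (∈-lookup {xs = xs} i)
  ... | y , y∈ , r = subst (R (lookup xs i)) (lookup-index y∈) r

-- The contour of a rooted tree in a map

-- T is the set of darts of a subgraph, Out the darts of T directed towards the parent of their
-- origin.  π moves a corner to the next corner in the walk around T.
module Contour {k : ℕ} (α σ π : Fin k → Fin k)
  (α-invol : ∀ d → α (α d) ≡ d)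
  (σ-injective : Injective _≡_ _≡_ σ)
  (π-injective : Injective _≡_ _≡_ π)
  (T : Fin k → Set) (T? : ∀ d → Dec (T d))
  (π-along : ∀ d → T (σ d) → π d ≡ α (σ d))
  (π-turn  : ∀ d → ¬ T (σ d) → π d ≡ σ d)
  (Out : Fin k → Set)
  (Out⇒T : ∀ {d} → Out d → T d)
  (Out⇒T-opposite : ∀ {d} → Out d → T (α d))
  (T⇒Out : ∀ {d} → T d → Out d ⊎ Out (α d))
  (Out-asym : ∀ {d} → Out d → ¬ Out (α d))
  (Out-unique : ∀ {o o′} → Out o → Out o′ → Reaches σ o o′ → o ≡ o′)
  (root : Fin k)
  (root-noOut : ∀ {d} → Reaches σ root d → ¬ Out d)
  where

  module Oσ = Orbit σ-injective
  module Oπ = Orbit π-injective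

  data Depth : ℕ → Fin k → Set where
    at-root : ∀ {d} → Reaches σ root d → Depth 0 d
    below   : ∀ {m d o} → Reaches σ d o → Out o → Depth m (α o) → Depth (suc m) d

  depth-rotate : ∀ {m d d′} → Reaches σ d d′ → Depth m d → Depth m d′
  depth-rotate r (at-root s)   = at-root (reaches-trans s r)
  depth-rotate r (below s o p) = below (reaches-trans (Oσ.reaches-sym r) s) o p

  depth-unique : ∀ {m n d} → Depth m d → Depth n d → m ≡ n
  depth-unique (at-root _)   (at-root _)      = refl
  depth-unique (at-root r)   (below s o _)    = ⊥-elim (root-noOut (reaches-trans r s) o)
  depth-unique (below s o _) (at-root r)      = ⊥-elim (root-noOut (reaches-trans r s) o)
  depth-unique (below s o p) (below s′ o′ p′)
    with refl ← Out-unique o o′ (reaches-trans (Oσ.reaches-sym s) s′) = cong suc (depth-unique p p′)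

  ancestor : ∀ {m d} → Depth m d → ∀ i → i ≤ m → Σ (Fin k) (Depth i)
  ancestor p i i≤m with m≤n⇒m<n∨m≡n i≤m
  ancestor {d = d} p i i≤m   | inj₂ refl = d , p
  ancestor (below _ _ p) i _ | inj₁ i<m  = ancestor p i (s≤s⁻¹ i<m)

  -- Otherwise the ancestors at depths 0 to `k` would be `k + 1` darts, two of them equal, against
  -- the uniqueness of depth. The bound supplies the fuel of `turn`.
  depth<k : ∀ {m d} → Depth m d → m < k
  depth<k {m} p = ≰⇒> λ k≤m →
    let anc : (i : Fin (suc k)) → Σ (Fin k) (Depth (toℕ i))
        anc i = ancestor p (toℕ i) (≤-trans (s≤s⁻¹ (toℕ<n i)) k≤m)
        (i , j , i<j , e) = pigeonhole (n<1+n k) (λ i → proj₁ (anc i))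
    in <⇒≢ i<j (depth-unique (proj₂ (anc i)) (subst (Depth (toℕ j)) (sym e) (proj₂ (anc j))))

  -- Induction on the height of the subtrees, bounded by k ∸ depth: the walk enters the child
  -- through α (σ d), visits all its corners, and comes back to the corner σ d.
  mutual
    turn : ∀ fuel {m d} → k ≤ m + fuel → Depth m d → ¬ Out (σ d) → Reaches π d (σ d)
    turn zero {m} b p _ = ⊥-elim (<⇒≱ (depth<k p) (subst (k ≤_) (+-identityʳ m) b))
    turn (suc fuel) {m} {d} b p ¬o with T? (σ d)
    ... | no ¬t = 1 , π-turn d ¬t
    ... | yes t with T⇒Out t
    ...   | inj₁ o = ⊥-elim (¬o o)
    ...   | inj₂ o with Oσ.preimage (α (σ d))
    ...     | z , ez , r = reaches-trans (1 , π-along d t)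
                (reaches-trans (around fuel (subst (k ≤_) (+-suc m fuel) b) q o r) (1 , back))
      where
      q : Depth (suc m) (α (σ d))
      q = below reaches-refl o (subst (Depth m) (sym (α-invol (σ d))) (depth-rotate (1 , refl) p))
      back : π z ≡ σ d
      back = trans (π-along z (subst T (sym ez) (Out⇒T o))) (trans (cong α ez) (α-invol (σ d)))

    around : ∀ fuel {m o} → k ≤ m + fuel → Depth m o → Out o → ∀ {z} → Reaches σ o z → Reaches π o z
    around fuel b p o (zero , refl) = reaches-refl
    around fuel b p o {z} (suc i , refl) with around fuel b p o (i , refl) | T? z
    ... | ih | no ¬t = reaches-trans ih (1 , π-turn _ ¬t)
    ... | ih | yes t with T⇒Out t
    -- The rotation is back at the parent dart, where it began.
    ...   | inj₁ o′ = 0 , Out-unique o o′ (suc i , refl)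
    ...   | inj₂ o′ = reaches-trans ih (turn fuel b (depth-rotate (i , refl) p)
                        λ o″ → Out-asym o″ o′)

  root⇒orbit : ∀ i → Reaches π root (iter σ i root)
  root⇒orbit zero    = reaches-refl
  root⇒orbit (suc i) = reaches-trans (root⇒orbit i)
    (turn k ≤-refl (at-root (i , refl)) (root-noOut (suc i , refl)))

  depth⇒orbit : ∀ m {d} → Depth m d → Reaches π root d
  depth⇒orbit zero (at-root (i , refl)) = root⇒orbit i
  depth⇒orbit (suc m) (below {o = o} s out p) with Oσ.preimage (α o)
  ... | z , ez , r = reaches-trans (depth⇒orbit m (depth-rotate r p)) (reaches-trans (1 , down)
          (around k (m≤n+m k (suc m)) (below reaches-refl out p) out (Oσ.reaches-sym s)))
    where
    down : π z ≡ o
    down = trans (π-along z (subst T (sym ez) (Out⇒T-opposite out))) (trans (cong α ez) (α-invol o))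

  depth-π : ∀ {m d} → Depth m d → ∃ λ m′ → Depth m′ (π d)
  depth-π {m} {d} p with T? (σ d)
  ... | no ¬t = m , subst (Depth m) (sym (π-turn d ¬t)) (depth-rotate (1 , refl) p)
  ... | yes t with T⇒Out t
  ...   | inj₂ o = suc m , subst (Depth (suc m)) (sym (π-along d t))
                     (below reaches-refl o (subst (Depth m) (sym (α-invol (σ d))) (depth-rotate (1 , refl) p)))
  ...   | inj₁ o with depth-rotate {d′ = σ d} (1 , refl) p
  ...     | at-root r = ⊥-elim (root-noOut r o)
  ...     | below {m′} s o′ p′ with refl ← Out-unique o o′ s = m′ , subst (Depth m′) (sym (π-along d t)) p′

  orbit⇒depth : ∀ {d} → Reaches π root d → ∃ λ m → Depth m d
  orbit⇒depth (zero , refl)  = 0 , at-root reaches-refl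
  orbit⇒depth (suc i , refl) = depth-π (proj₂ (orbit⇒depth (i , refl)))

  -- The orbit of the root consists exactly of the darts that have a depth, and depth depends only
  -- on the vertex. So the orbit is a union of vertices.
  orbit-rotate : ∀ {d d′} → Reaches π root d → Reaches σ d d′ → Reaches π root d′
  orbit-rotate s r = depth⇒orbit _ (depth-rotate r (proj₂ (orbit⇒depth s)))

-- The local rule as a relation between consecutive darts

next : Colour → Colour
next blue  = red
next red   = green
next green = blue

-- An ingoing edge lies inside the sector of its own colour; an outgoing edge of colour `c` opens
-- the sector of colour `next c`. The outgoing edge that closes a sector of colour `c` has colour
-- `next c` as well, whence the form of `Follows`.
cornerAfter : Bool × Colour → Colour
cornerAfter (true  , c) = next c
cornerAfter (false , c) = c

Follows : Bool × Colour → Bool × Colour → Set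
Follows l l′ = l′ ≡ (false , cornerAfter l) ⊎ l′ ≡ (true , next (cornerAfter l))

arith₁ : ∀ a j → suc a + j ≡ a + 1 + j
arith₁ = solve-∀
arith₂ : ∀ a b l → suc a + (suc b + l) ≡ a + b + 2 + l
arith₂ = solve-∀
arith₃ : ∀ a b l → suc (suc a + (suc b + l)) ≡ a + b + 3 + l
arith₃ = solve-∀
arith₄ : ∀ a b c → a + b + c + 3 ≡ a + b + 3 + c
arith₄ = solve-∀
arith₅ : ∀ a j → suc (a + 1 + j) ≡ a + j + 2
arith₅ = solve-∀
arith₆ : ∀ a b j → suc (a + b + 2 + j) ≡ a + b + j + 3
arith₆ = solve-∀

module Rotation {k : ℕ} (σ : Fin k → Fin k) (Lab : Fin k → Bool × Colour)
  (d : Fin k) (a b c : ℕ)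
  (L-blue   : Lab d ≡ (true , blue))
  (L-reds   : ∀ i → 1 ≤ i → i ≤ a → Lab (iter σ i d) ≡ (false , red))
  (L-green  : Lab (iter σ (a + 1) d) ≡ (true , green))
  (L-blues  : ∀ i → 1 ≤ i → i ≤ b → Lab (iter σ (a + 1 + i) d) ≡ (false , blue))
  (L-red    : Lab (iter σ (a + b + 2) d) ≡ (true , red))
  (L-greens : ∀ i → 1 ≤ i → i ≤ c → Lab (iter σ (a + b + 2 + i) d) ≡ (false , green))
  (turn     : iter σ (a + b + c + 3) d ≡ d)
  where

  p : ℕ
  p = a + b + c + 3

  L : ℕ → Bool × Colour
  L i = Lab (iter σ i d)

  -- Offset 0 is the outgoing edge that opens the sector; the ingoing edges have offsets from 1 on.
  data Sector (i : ℕ) : Set where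
    red-sector   : ∀ j → j ≤ a → i ≡ j → Sector i
    blue-sector  : ∀ j → j ≤ b → i ≡ a + 1 + j → Sector i
    green-sector : ∀ j → j ≤ c → i ≡ a + b + 2 + j → Sector i

  sector : ∀ i → i < p → Sector i
  sector i i<p with i ≤? a
  ... | yes i≤a = red-sector i i≤a refl
  ... | no i≰a with m≤n⇒∃[o]m+o≡n (≰⇒> i≰a)
  ...   | j , refl with j ≤? b
  ...     | yes j≤b = blue-sector j j≤b (arith₁ a j)
  ...     | no j≰b with m≤n⇒∃[o]m+o≡n (≰⇒> j≰b)
  ...       | l , refl = green-sector l (+-cancelˡ-≤ (a + b + 3) l c (subst₂ _≤_ (arith₃ a b l) (arith₄ a b c) i<p)) (arith₂ a b l)

  L-red-sector : ∀ j → j ≤ a → cornerAfter (L j) ≡ red × (L j ≡ (true , blue) → j ≡ 0)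
  L-red-sector zero    _   = cong cornerAfter L-blue , λ _ → refl
  L-red-sector (suc j) j≤a = cong cornerAfter e , λ e′ → ⊥-elim (case (trans (sym e) e′))
    where e = L-reds (suc j) (s≤s z≤n) j≤a
          case : (false , red) ≢ (true , blue)
          case ()

  L-blue-sector : ∀ j → j ≤ b → cornerAfter (L (a + 1 + j)) ≡ blue × L (a + 1 + j) ≢ (true , blue)
  L-blue-sector zero _ = cong cornerAfter e , λ e′ → case (trans (sym e) e′)
    where e : L (a + 1 + 0) ≡ (true , green)
          e = trans (cong L (+-identityʳ (a + 1))) L-green
          case : (true , green) ≢ (true , blue)
          case ()
  L-blue-sector (suc j) j≤b = cong cornerAfter e , λ e′ → case (trans (sym e) e′)
    where e = L-blues (suc j) (s≤s z≤n) j≤b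
          case : (false , blue) ≢ (true , blue)
          case ()

  L-green-sector : ∀ j → j ≤ c → cornerAfter (L (a + b + 2 + j)) ≡ green × L (a + b + 2 + j) ≢ (true , blue)
  L-green-sector zero _ = cong cornerAfter e , λ e′ → case (trans (sym e) e′)
    where e : L (a + b + 2 + 0) ≡ (true , red)
          e = trans (cong L (+-identityʳ (a + b + 2))) L-red
          case : (true , red) ≢ (true , blue)
          case ()
  L-green-sector (suc j) j≤c = cong cornerAfter e , λ e′ → case (trans (sym e) e′)
    where e = L-greens (suc j) (s≤s z≤n) j≤c
          case : (false , green) ≢ (true , blue)
          case ()

  follows : ∀ i → i < p → Follows (L i) (L (suc i))
  follows i i<p with sector i i<p
  follows i i<p | red-sector j j≤a refl rewrite proj₁ (L-red-sector j j≤a) with m≤n⇒m<n∨m≡n j≤a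
  ... | inj₁ j<a  = inj₁ (L-reds (suc j) (s≤s z≤n) j<a)
  ... | inj₂ refl = inj₂ (trans (cong L (+-comm 1 j)) L-green)
  follows i i<p | blue-sector j j≤b refl rewrite proj₁ (L-blue-sector j j≤b) with m≤n⇒m<n∨m≡n j≤b
  ... | inj₁ j<b  = inj₁ (trans (cong L (sym (+-suc (a + 1) j))) (L-blues (suc j) (s≤s z≤n) j<b))
  ... | inj₂ refl = inj₂ (trans (cong L (arith₅ a j)) L-red)
  follows i i<p | green-sector j j≤c refl rewrite proj₁ (L-green-sector j j≤c) with m≤n⇒m<n∨m≡n j≤c
  ... | inj₁ j<c  = inj₁ (trans (cong L (sym (+-suc (a + b + 2) j))) (L-greens (suc j) (s≤s z≤n) j<c))
  -- The last sector is closed by the outgoing blue edge `d` with which the rotation began.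
  ... | inj₂ refl = inj₂ (trans (cong L (arith₆ a b j)) (trans (cong Lab turn) L-blue))

  only-blue : ∀ i → i < p → L i ≡ (true , blue) → i ≡ 0
  only-blue i i<p e with sector i i<p
  ... | red-sector j j≤a refl   = proj₂ (L-red-sector j j≤a) e
  ... | blue-sector j j≤b refl  = ⊥-elim (proj₂ (L-blue-sector j j≤b) e)
  ... | green-sector j j≤c refl = ⊥-elim (proj₂ (L-green-sector j j≤c) e)

  position : ∀ {x} → Reaches σ d x → Σ ℕ λ i → i < p × iter σ i d ≡ x
  position (m , e) = m % p , m%n<n m p , trans (iter-% σ p turn m) e
    where instance nz : NonZero p
                   nz = subst NonZero (+-comm 3 (a + b + c)) _

  follows-at : ∀ {x} → Reaches σ d x → Follows (Lab x) (Lab (σ x))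
  follows-at r with position r
  ... | i , i<p , refl = follows i i<p

  out-blue-unique : ∀ {x} → Reaches σ d x → Lab x ≡ (true , blue) → x ≡ d
  out-blue-unique r l with position r
  ... | i , i<p , refl with refl ← only-blue i i<p l = refl

-- Vertices and triangular faces

module SchnyderWood {k : ℕ} (M : Map k) (tri : IsRootedTriangulation M)
                    (W : Wood k) (wood : WoodOps.IsSchnyderWood M W) where

  open WoodOps M W public
  open IsRootedTriangulation tri
  open IsSchnyderWood wood

  α-injective : Injective _≡_ _≡_ α
  α-injective {x} {y} e = trans (sym (α-invol x)) (trans (cong α e) (α-invol y))

  φ-injective : Injective _≡_ _≡_ φ
  φ-injective e = σ-perm (α-injective e)

  module Oσ = Orbit σ-perm
  module Oφ = Orbit φ-injective

  opaque
    vertex : ∀ {x y} → Reaches σ x y → SameVertex x y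
    vertex = Oσ.reaches-bounded

    vertex⁻ : ∀ {x y} → SameVertex x y → Reaches σ x y
    vertex⁻ (i , e) = toℕ i , e

    vertex-refl : ∀ {x} → SameVertex x x
    vertex-refl = vertex reaches-refl

    vertex-sym : ∀ {x y} → SameVertex x y → SameVertex y x
    vertex-sym s = vertex (Oσ.reaches-sym (vertex⁻ s))

    vertex-trans : ∀ {x y z} → SameVertex x y → SameVertex y z → SameVertex x z
    vertex-trans s t = vertex (reaches-trans (vertex⁻ s) (vertex⁻ t))

    vertex-σ : ∀ {x} → SameVertex x (σ x)
    vertex-σ = vertex (1 , refl)

  φ³ : ∀ d → φ (φ (φ d)) ≡ d
  φ³ d = proj₁ (triangular d)

  vertex≢ : ∀ d → ¬ SameVertex d (φ d)
  vertex≢ d s = no-loop (σ d) (vertex-trans (vertex-sym vertex-σ) s)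

  data Face (x : Fin k) : Fin k → Set where
    at₀ : Face x x
    at₁ : Face x (φ x)
    at₂ : Face x (φ (φ x))

  face⁻ : ∀ {x y} → Reaches φ x y → Face x y
  face⁻ (zero , refl) = at₀
  face⁻ {x} (suc i , refl) with face⁻ {x} (i , refl)
  ... | f = step f
    where step : ∀ {z} → Face x z → Face x (φ z)
          step at₀ = at₁
          step at₁ = at₂
          step at₂ = subst (Face x) (sym (φ³ x)) at₀

  face⁻′ : ∀ {x y} → SameFace x y → Face x y
  face⁻′ (i , e) = face⁻ (toℕ i , e)

  face : ∀ {x y} → Face x y → SameFace x y
  face at₀ = Oφ.reaches-bounded (0 , refl)
  face at₁ = Oφ.reaches-bounded (1 , refl)
  face at₂ = Oφ.reaches-bounded (2 , refl)

  face-sym : ∀ {x y} → SameFace x y → SameFace y x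
  face-sym (i , e) = Oφ.reaches-bounded (Oφ.reaches-sym (toℕ i , e))

  face-trans : ∀ {x y z} → SameFace x y → SameFace y z → SameFace x z
  face-trans (i , e) (j , e′) = Oφ.reaches-bounded (reaches-trans (toℕ i , e) (toℕ j , e′))

  -- The outer face

  ασdR : α (σ dR) ≡ dB
  ασdR = φ³ ρ

  α-dB : α dB ≡ σ dR
  α-dB = trans (cong α (sym ασdR)) (α-invol (σ dR))

  α-dG : α dG ≡ σ dB
  α-dG = α-invol (σ dB)

  α-dR : α dR ≡ σ dG
  α-dR = α-invol (σ dG)

  B≁G : ¬ SameVertex dB dG
  B≁G = vertex≢ dB

  G≁R : ¬ SameVertex dG dR
  G≁R = vertex≢ dG

  B≁R : ¬ SameVertex dB dR
  B≁R s = vertex≢ dR (subst (SameVertex dR) (sym ασdR) (vertex-sym s))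

  data OuterCase : Fin k → Set where
    oB  : OuterCase dB
    oG  : OuterCase dG
    oR  : OuterCase dR
    oσB : OuterCase (σ dB)
    oσG : OuterCase (σ dG)
    oσR : OuterCase (σ dR)

  outer-case : ∀ {y} → OuterDart y → OuterCase y
  outer-case (inj₁ (inj₁ refl))        = oσB
  outer-case (inj₁ (inj₂ (inj₁ refl))) = oσG
  outer-case (inj₁ (inj₂ (inj₂ refl))) = oσR
  outer-case {y} (inj₂ (inj₁ e)) rewrite trans (sym (α-invol y)) (cong α e) = oG
  outer-case {y} (inj₂ (inj₂ (inj₁ e))) rewrite trans (sym (α-invol y)) (cong α e) = oR
  outer-case {y} (inj₂ (inj₂ (inj₂ e))) rewrite trans (sym (α-invol y)) (trans (cong α e) ασdR) = oB

  outer : ∀ {y} → OuterCase y → OuterDart y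
  outer oB  = inj₂ (inj₂ (inj₂ α-dB))
  outer oG  = inj₂ (inj₁ α-dG)
  outer oR  = inj₂ (inj₂ (inj₁ α-dR))
  outer oσB = inj₁ (inj₁ refl)
  outer oσG = inj₁ (inj₂ (inj₁ refl))
  outer oσR = inj₁ (inj₂ (inj₂ refl))

  outer-α : ∀ {y} → OuterDart y → OuterDart (α y)
  outer-α o with outer-case o
  ... | oB  rewrite α-dB = outer oσR
  ... | oG  rewrite α-dG = outer oσB
  ... | oR  rewrite α-dR = outer oσG
  ... | oσB = outer oG
  ... | oσG = outer oR
  ... | oσR rewrite ασdR = outer oB

  inner-α : ∀ {y} → ¬ OuterDart y → ¬ OuterDart (α y)
  inner-α {y} ¬o o = ¬o (subst OuterDart (α-invol y) (outer-α o))

  data VertexCase (x : Fin k) : Set where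
    atB   : SameVertex dB x → VertexCase x
    atG   : SameVertex dG x → VertexCase x
    atR   : SameVertex dR x → VertexCase x
    inner : InnerVertex x → VertexCase x

  vertex-case : ∀ x → VertexCase x
  vertex-case x with sameVertex? x dB | sameVertex? x dG | sameVertex? x dR
  ... | yes s | _     | _     = atB (vertex-sym s)
  ... | no ¬b | yes s | _     = atG (vertex-sym s)
  ... | no ¬b | no ¬g | yes s = atR (vertex-sym s)
  ... | no ¬b | no ¬g | no ¬r = inner (¬b , ¬g , ¬r)

  opaque
    inner-vertex⇒inner : ∀ {x} → InnerVertex x → ¬ OuterDart x
    inner-vertex⇒inner (¬b , ¬g , ¬r) o with outer-case o
    ... | oB  = ¬b vertex-refl
    ... | oG  = ¬g vertex-refl
    ... | oR  = ¬r vertex-refl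
    ... | oσB = ¬b (vertex-sym vertex-σ)
    ... | oσG = ¬g (vertex-sym vertex-σ)
    ... | oσR = ¬r (vertex-sym vertex-σ)

    inner-vertex-resp : ∀ {x y} → SameVertex x y → InnerVertex x → InnerVertex y
    inner-vertex-resp s (¬b , ¬g , ¬r) =
      (λ t → ¬b (vertex-trans s t)) , (λ t → ¬g (vertex-trans s t)) , (λ t → ¬r (vertex-trans s t))

    -- At u_B, u_G and u_R all inner edges are ingoing.
    out⇒inner-vertex : ∀ {x} → ¬ OuterDart x → out x ≡ true → InnerVertex x
    out⇒inner-vertex {x} ¬o e with vertex-case x
    ... | inner i = i
    ... | atB s with () ← trans (sym e) (cong proj₁ (at-uB x ¬o s))
    ... | atG s with () ← trans (sym e) (cong proj₁ (at-uG x ¬o s))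
    ... | atR s with () ← trans (sym e) (cong proj₁ (at-uR x ¬o s))

  -- Corner colours

  opaque
    -- Reads the colour from the dart just before the corner, where `CornerColour` searches forward
    -- for the next outgoing edge. `corner-colour` and `corner-colour⁻` show that the two agree.
    cc : Fin k → Colour
    cc x with vertex-case x
    ... | atB _   = blue
    ... | atG _   = green
    ... | atR _   = red
    ... | inner _ = cornerAfter (Lab x)

    cc-B : ∀ {x} → SameVertex dB x → cc x ≡ blue
    cc-B {x} s with vertex-case x
    ... | atB _   = refl
    ... | atG t   = ⊥-elim (B≁G (vertex-trans s (vertex-sym t)))
    ... | atR t   = ⊥-elim (B≁R (vertex-trans s (vertex-sym t)))
    ... | inner i = ⊥-elim (proj₁ i (vertex-sym s))

    cc-G : ∀ {x} → SameVertex dG x → cc x ≡ green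
    cc-G {x} s with vertex-case x
    ... | atB t   = ⊥-elim (B≁G (vertex-trans t (vertex-sym s)))
    ... | atG _   = refl
    ... | atR t   = ⊥-elim (G≁R (vertex-trans s (vertex-sym t)))
    ... | inner i = ⊥-elim (proj₁ (proj₂ i) (vertex-sym s))

    cc-R : ∀ {x} → SameVertex dR x → cc x ≡ red
    cc-R {x} s with vertex-case x
    ... | atB t   = ⊥-elim (B≁R (vertex-trans t (vertex-sym s)))
    ... | atG t   = ⊥-elim (G≁R (vertex-trans t (vertex-sym s)))
    ... | atR _   = refl
    ... | inner i = ⊥-elim (proj₂ (proj₂ i) (vertex-sym s))

    cc-inner-vertex : ∀ {x} → InnerVertex x → cc x ≡ cornerAfter (Lab x)
    cc-inner-vertex {x} i with vertex-case x
    ... | atB t   = ⊥-elim (proj₁ i (vertex-sym t))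
    ... | atG t   = ⊥-elim (proj₁ (proj₂ i) (vertex-sym t))
    ... | atR t   = ⊥-elim (proj₂ (proj₂ i) (vertex-sym t))
    ... | inner _ = refl

    -- At an outer vertex every inner edge is ingoing in the colour of the vertex, so the formula
    -- for inner vertices persists there.
    cc-inner : ∀ {x} → ¬ OuterDart x → cc x ≡ cornerAfter (Lab x)
    cc-inner {x} ¬o with vertex-case x
    ... | atB t rewrite at-uB x ¬o t = refl
    ... | atG t rewrite at-uG x ¬o t = refl
    ... | atR t rewrite at-uR x ¬o t = refl
    ... | inner _ = refl

  OuterCorner : Fin k → Set
  OuterCorner x = Face ρ x

  inner-vertex-rotation : ∀ {x} → InnerVertex x → Σ (Fin k) λ o → Reaches σ x o × Lab o ≡ (true , blue)
    × (∀ {z} → Reaches σ o z → Follows (Lab z) (Lab (σ z)))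
    × (∀ {z} → Reaches σ o z → Lab z ≡ (true , blue) → z ≡ o)
  inner-vertex-rotation {x} i with local x i
  ... | d , s , a , b , c , blue₁ , reds , green₁ , blues , red₁ , greens , turn , _ =
    d , vertex⁻ s , blue₁ , R.follows-at , R.out-blue-unique
    where module R = Rotation σ Lab d a b c blue₁ reds green₁ blues red₁ greens turn

  opaque
    unfolding cc

    -- Extends the local rule to outer vertices, where only the ingoing alternative occurs. The dart
    -- `x` itself may be outer.
    follows-cc : ∀ x → ¬ OuterDart (σ x) →
                 Lab (σ x) ≡ (false , cc x) ⊎ Lab (σ x) ≡ (true , next (cc x))
    follows-cc x ¬o with vertex-case x
    ... | atB s = inj₁ (at-uB (σ x) ¬o (vertex-trans s vertex-σ))
    ... | atG s = inj₁ (at-uG (σ x) ¬o (vertex-trans s vertex-σ))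
    ... | atR s = inj₁ (at-uR (σ x) ¬o (vertex-trans s vertex-σ))
    ... | inner i with inner-vertex-rotation i
    ...   | o , r , _ , follows , _ = follows (Oσ.reaches-sym r)

  Lab-α : ∀ {x b c} → ¬ OuterDart x → Lab x ≡ (b , c) → Lab (α x) ≡ (not b , c)
  Lab-α {x} ¬o refl = cong₂ _,_ (proj₂ (inner-edge x ¬o)) (proj₁ (inner-edge x ¬o))

  -- If `σ x` is ingoing, it has colour `cc x` and its opposite opens a sector of colour
  -- `next (cc x)`. If it is outgoing, it already has colour `next (cc x)` and its opposite, being
  -- ingoing, is followed by a corner of that colour.
  cc-φ-along : ∀ {x} → ¬ OuterDart (σ x) → cc (φ x) ≡ next (cc x)
  cc-φ-along {x} ¬o = trans (cc-inner (inner-α ¬o)) (opposite (follows-cc x ¬o))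
    where
    opposite : Lab (σ x) ≡ (false , cc x) ⊎ Lab (σ x) ≡ (true , next (cc x)) →
               cornerAfter (Lab (φ x)) ≡ next (cc x)
    opposite (inj₁ e) = cong cornerAfter (Lab-α ¬o e)
    opposite (inj₂ e) = cong cornerAfter (Lab-α ¬o e)

  -- Labels say nothing about outer edges, so the colours of their ends are compared directly. If
  -- `σ x` were one of the three clockwise tails, `x` would lie in the outer face.
  cc-φ-outer : ∀ {x z} → ¬ OuterCorner x → OuterCase z → z ≡ σ x → cc (φ x) ≡ next (cc x)
  cc-φ-outer {x} ¬c oB e = trans
    (cc-R (subst (SameVertex dR) (trans (sym α-dB) (cong α e)) vertex-σ))
    (cong next (sym (cc-B (vertex-sym (subst (SameVertex x) (sym e) vertex-σ)))))
  cc-φ-outer {x} ¬c oG e = trans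
    (cc-B (subst (SameVertex dB) (trans (sym α-dG) (cong α e)) vertex-σ))
    (cong next (sym (cc-G (vertex-sym (subst (SameVertex x) (sym e) vertex-σ)))))
  cc-φ-outer {x} ¬c oR e = trans
    (cc-G (subst (SameVertex dG) (trans (sym α-dR) (cong α e)) vertex-σ))
    (cong next (sym (cc-R (vertex-sym (subst (SameVertex x) (sym e) vertex-σ)))))
  cc-φ-outer ¬c oσB e = ⊥-elim (¬c (subst OuterCorner (σ-perm e) at₀))
  cc-φ-outer ¬c oσG e = ⊥-elim (¬c (subst OuterCorner (σ-perm e) at₁))
  cc-φ-outer ¬c oσR e = ⊥-elim (¬c (subst OuterCorner (σ-perm e) at₂))

  cc-φ : ∀ {x} → ¬ OuterCorner x → cc (φ x) ≡ next (cc x)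
  cc-φ {x} ¬c = by-cases (outerDart? (σ x))
    where
    by-cases : Dec (OuterDart (σ x)) → cc (φ x) ≡ next (cc x)
    by-cases (yes o) = cc-φ-outer ¬c (outer-case o) refl
    by-cases (no ¬o) = cc-φ-along ¬o

  inner-φ : ∀ {x} → ¬ OuterCorner x → ¬ OuterCorner (φ x)
  inner-φ {x} ¬c c = ¬c (face⁻′ (face-trans (face c) (face-sym (face (at₁ {x})))))

  out-blue : ∀ {x} → InnerVertex x → Σ (Fin k) λ o → SameVertex x o × Lab o ≡ (true , blue)
  out-blue i with inner-vertex-rotation i
  ... | o , r , e , _ = o , vertex r , e

  out-blue-unique : ∀ {x y} → InnerVertex x → Reaches σ x y →
                    Lab x ≡ (true , blue) → Lab y ≡ (true , blue) → x ≡ y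
  out-blue-unique i s e e′ with inner-vertex-rotation i
  ... | o , r , _ , _ , unique = trans (unique (Oσ.reaches-sym r) e) (sym (unique (reaches-trans (Oσ.reaches-sym r) s) e′))

module Spanning {k : ℕ} (M : Map k) (tri : IsRootedTriangulation M)
                (W : Wood k) (wood : WoodOps.IsSchnyderWood M W) where

  open SchnyderWood M tri W wood
  open IsRootedTriangulation tri
  open IsSchnyderWood wood

  -- Legs

  next-sector : ∀ c → c ≡ sectorColour (next c)
  next-sector blue  = refl
  next-sector green = refl
  next-sector red   = refl

  next≢ : ∀ c → next c ≢ c
  next≢ blue  ()
  next≢ green ()
  next≢ red   ()

  next²≢ : ∀ c → next (next c) ≢ c
  next²≢ blue  ()
  next²≢ green ()
  next²≢ red   ()

  σ-inner-vertex : ∀ {x} → InnerVertex x → InnerVertex (σ x)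
  σ-inner-vertex = inner-vertex-resp vertex-σ

  σ-inner : ∀ {x} → InnerVertex x → ¬ OuterDart (σ x)
  σ-inner i = inner-vertex⇒inner (σ-inner-vertex i)

  -- Passing an ingoing dart keeps the corner colour, so the recursion moves to the first outgoing
  -- dart, whose colour is `next` of the sector; `sectorColour` undoes `next`.
  first-out : ∀ j {x} → InnerVertex x → out (iter σ (suc j) x) ≡ true →
              (∀ i → 1 ≤ i → i < suc j → out (iter σ i x) ≡ false) →
              cc x ≡ sectorColour (col (iter σ (suc j) x))
  first-out zero {x} i e _ with follows-cc x (σ-inner i)
  ... | inj₁ l with () ← trans (sym e) (cong proj₁ l)
  ... | inj₂ l = trans (next-sector (cc x)) (cong sectorColour (sym (cong proj₂ l)))
  first-out (suc j) {x} i e before with follows-cc x (σ-inner i)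
  ... | inj₂ l with () ← trans (sym (before 1 ≤-refl (s≤s (s≤s z≤n)))) (cong proj₁ l)
  ... | inj₁ l = trans (sym (trans (cc-inner (σ-inner i)) (cong cornerAfter l)))
      (trans (first-out j (σ-inner-vertex i) (trans (cong out shift) e)
               λ l 1≤l l<j → trans (cong out (iter-shift σ l x)) (before (suc l) (s≤s z≤n) (s≤s l<j)))
             (cong (λ z → sectorColour (col z)) shift))
    where shift : iter σ (suc j) (σ x) ≡ iter σ (suc (suc j)) x
          shift = iter-shift σ (suc j) x

  corner-colour⁻ : ∀ {x c} → CornerColour x c → cc x ≡ c
  corner-colour⁻ (inj₁ (s , refl)) = cc-B (vertex-sym s)
  corner-colour⁻ (inj₂ (inj₁ (s , refl))) = cc-G (vertex-sym s)
  corner-colour⁻ (inj₂ (inj₂ (inj₁ (s , refl)))) = cc-R (vertex-sym s)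
  corner-colour⁻ (inj₂ (inj₂ (inj₂ (i , zero , () , _))))
  corner-colour⁻ (inj₂ (inj₂ (inj₂ (i , suc j , _ , e , before , refl)))) = first-out j i e before

  corner-colour : ∀ x → CornerColour x (cc x)
  corner-colour x = by-cases (vertex-case x)
    where
    by-cases : VertexCase x → CornerColour x (cc x)
    by-cases (atB s) = inj₁ (vertex-sym s , cc-B s)
    by-cases (atG s) = inj₂ (inj₁ (vertex-sym s , cc-G s))
    by-cases (atR s) = inj₂ (inj₂ (inj₁ (vertex-sym s , cc-R s)))
    by-cases (inner i) with out-blue i
    -- The outgoing blue dart `o` makes the search for an outgoing dart end; passing through its
    -- preimage under `σ` gives it an offset of at least 1.
    ... | o , s , l with Oσ.preimage o
    ...   | z , ez , r with reaches-trans (vertex⁻ s) r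
    ...     | m , em with least (λ j → out (iter σ (suc j) x) ≟B true) m
                          (trans (cong out (trans (cong σ em) ez)) (cong proj₁ l))
    ...       | j , _ , e , before = inj₂ (inj₂ (inj₂ (i , suc j , s≤s z≤n , e , before′ , first-out j i e before′)))
      where
      false-unless : ∀ b → b ≢ true → b ≡ false
      false-unless true  ne = ⊥-elim (ne refl)
      false-unless false _  = refl
      before′ : ∀ l → 1 ≤ l → l < suc j → out (iter σ l x) ≡ false
      before′ (suc l) _ l<j = false-unless _ (before l (s≤s⁻¹ l<j))

  leg : ∀ {x f} → SameFace x f → Oriented (φ x) → LegAt f (cc x)
  leg {x} s o = φ x , o , face-trans (face-sym (face at₁)) s , x , s
              , vertex (1 , sym (α-invol (σ x))) , corner-colour x

  -- Of the three darts in the face of `x`, only `φ x` ends at the vertex of `x`, since there are no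
  -- loops. With `leg`, this reduces legs to the orientation of `φ x`.
  leg⁻ : ∀ {f c} → LegAt f c → Σ (Fin k) λ x → SameFace x f × cc x ≡ c × Oriented (φ x)
  leg⁻ (y , o , sy , x , sx , v , c) with face⁻′ (face-trans sx (face-sym sy))
  ... | at₀ = ⊥-elim (no-loop x v)
  ... | at₁ = x , sx , corner-colour⁻ c , o
  ... | at₂ = ⊥-elim (vertex≢ x (vertex-trans (subst (SameVertex x) (α-invol (σ (φ x))) v) (vertex-sym vertex-σ)))

  cc-φφ : ∀ {x} → ¬ OuterCorner x → cc (φ (φ x)) ≡ next (next (cc x))
  cc-φφ ¬c = trans (cc-φ (inner-φ ¬c)) (cong next (cc-φ ¬c))

  -- By `cc-φ` the three corners of an inner face have three different colours.
  same-colour : ∀ {x y} → ¬ OuterCorner x → Face x y → cc x ≡ cc y → x ≡ y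
  same-colour ¬c at₀ e = refl
  same-colour ¬c at₁ e = ⊥-elim (next≢ _ (sym (trans e (cc-φ ¬c))))
  same-colour ¬c at₂ e = ⊥-elim (next²≢ _ (sym (trans e (cc-φφ ¬c))))

  leg⇒oriented : ∀ {x c} → ¬ OuterCorner x → cc x ≡ c → LegAt x c → Oriented (φ x)
  leg⇒oriented {x} ¬c e l with leg⁻ l
  ... | z , s , e′ , o = subst (λ w → Oriented (φ w)) (sym (same-colour ¬c (face⁻′ (face-sym s)) (trans e (sym e′)))) o

  legAt-face : ∀ {f f′ c} → SameFace f f′ → LegAt f c → LegAt f′ c
  legAt-face s (y , o , sy , x , sx , r) = y , o , face-trans sy s , x , face-trans sx s , r

  -- The blue tree and its dual

  data Tree (d : Fin k) : Set where
    tree  : TreeDart d → Tree d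
    to-G  : d ≡ σ dB → Tree d
    from-G : d ≡ dG → Tree d

  Tree? : ∀ d → Dec (Tree d)
  Tree? d with treeDart? d | d ≟F σ dB | d ≟F dG
  ... | yes t | _     | _     = yes (tree t)
  ... | no ¬t | yes e | _     = yes (to-G e)
  ... | no ¬t | no ¬e | yes e = yes (from-G e)
  ... | no ¬t | no ¬e | no ¬f = no λ { (tree t) → ¬t t ; (to-G e) → ¬e e ; (from-G e) → ¬f e }

  treeDart-α : ∀ {d} → TreeDart d → TreeDart (α d)
  treeDart-α (inj₁ (¬o , e))     = inj₁ (inner-α ¬o , trans (proj₁ (inner-edge _ ¬o)) e)
  treeDart-α (inj₂ (inj₁ refl))  = inj₂ (inj₂ refl)
  treeDart-α (inj₂ (inj₂ refl))  = inj₂ (inj₁ (α-invol ρ))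

  tree-α : ∀ {d} → Tree d → Tree (α d)
  tree-α (tree t)      = tree (treeDart-α t)
  tree-α (to-G refl)   = from-G refl
  tree-α (from-G refl) = to-G α-dG

  tree-α⁻ : ∀ {d} → Tree (α d) → Tree d
  tree-α⁻ {d} t = subst Tree (α-invol d) (tree-α t)

  π : Fin k → Fin k
  π d = if does (Tree? (σ d)) then α (σ d) else σ d

  π-along : ∀ d → Tree (σ d) → π d ≡ α (σ d)
  π-along d t rewrite dec-true (Tree? (σ d)) t = refl

  π-turn : ∀ d → ¬ Tree (σ d) → π d ≡ σ d
  π-turn d ¬t rewrite dec-false (Tree? (σ d)) ¬t = refl

  -- The two kinds of step have disjoint images: following an edge lands on a dart of `Tree`,
  -- turning lands on a dart outside it.
  π-injective : Injective _≡_ _≡_ π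
  π-injective {x} {y} e = by-cases (Tree? (σ x)) (Tree? (σ y))
    where
    by-cases : Dec (Tree (σ x)) → Dec (Tree (σ y)) → x ≡ y
    by-cases (yes t) (yes u) = φ-injective (trans (sym (π-along x t)) (trans e (π-along y u)))
    by-cases (no ¬t) (no ¬u) = σ-perm (trans (sym (π-turn x ¬t)) (trans e (π-turn y ¬u)))
    by-cases (yes t) (no ¬u) = ⊥-elim (¬u (subst Tree (trans (sym (π-along x t)) (trans e (π-turn y ¬u))) (tree-α t)))
    by-cases (no ¬t) (yes u) = ⊥-elim (¬t (subst Tree (trans (sym (π-along y u)) (trans (sym e) (π-turn x ¬t))) (tree-α u)))

  data Up : Fin k → Set where
    up-inner : ∀ {d} → ¬ OuterDart d → Lab d ≡ (true , blue) → Up d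
    up-R     : Up (α ρ)
    up-G     : Up dG

  αρ-at-R : SameVertex dR (α ρ)
  αρ-at-R = subst (SameVertex dR) (sym α-dB) vertex-σ

  up-inner-vertex : ∀ {d} → ¬ OuterDart d → Lab d ≡ (true , blue) → InnerVertex d
  up-inner-vertex ¬o l = out⇒inner-vertex ¬o (cong proj₁ l)

  up-tree : ∀ {d} → Up d → Tree d
  up-tree (up-inner ¬o l) = tree (inj₁ (¬o , cong proj₂ l))
  up-tree up-R            = tree (inj₂ (inj₂ refl))
  up-tree up-G            = from-G refl

  outer-αρ : OuterDart (α ρ)
  outer-αρ = outer-α (outer oB)

  tree-up : ∀ {d} → Tree d → Up d ⊎ Up (α d)
  tree-up {d} (tree (inj₁ (¬o , e))) with out d in eo
  ... | true  = inj₁ (up-inner ¬o (cong₂ _,_ eo e))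
  ... | false = inj₂ (up-inner (inner-α ¬o) (Lab-α ¬o (cong₂ _,_ eo e)))
  tree-up (tree (inj₂ (inj₁ refl))) = inj₂ up-R
  tree-up (tree (inj₂ (inj₂ refl))) = inj₁ up-R
  tree-up (to-G refl)               = inj₂ up-G
  tree-up (from-G refl)             = inj₁ up-G

  up⇒not-at-B : ∀ {d} → SameVertex dB d → ¬ Up d
  up⇒not-at-B s (up-inner ¬o l) with () ← trans (sym l) (at-uB _ ¬o s)
  up⇒not-at-B s up-R            = B≁R (vertex-trans s (vertex-sym αρ-at-R))
  up⇒not-at-B s up-G            = B≁G s

  up-asym : ∀ {d} → Up d → ¬ Up (α d)
  up-asym (up-inner ¬o l) u = asym (Lab-α ¬o l) (inner-α ¬o) u
    where
    asym : ∀ {z} → Lab z ≡ (false , blue) → ¬ OuterDart z → ¬ Up z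
    asym e _  (up-inner _ e′) with () ← trans (sym e) e′
    asym _ ¬o up-R            = ¬o outer-αρ
    asym _ ¬o up-G            = ¬o (outer oG)
  up-asym up-R u = up⇒not-at-B vertex-refl (subst Up (α-invol ρ) u)
  up-asym up-G u = up⇒not-at-B vertex-σ (subst Up α-dG u)

  up-unique : ∀ {d d′} → Up d → Up d′ → Reaches σ d d′ → d ≡ d′
  up-unique (up-inner ¬o l) (up-inner ¬o′ l′) r = out-blue-unique (up-inner-vertex ¬o l) r l l′
  up-unique (up-inner ¬o l) up-R r = ⊥-elim (proj₂ (proj₂ (up-inner-vertex ¬o l)) (vertex-trans (vertex r) (vertex-sym αρ-at-R)))
  up-unique (up-inner ¬o l) up-G r = ⊥-elim (proj₁ (proj₂ (up-inner-vertex ¬o l)) (vertex r))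
  up-unique up-R (up-inner ¬o l) r = ⊥-elim (proj₂ (proj₂ (up-inner-vertex ¬o l)) (vertex-sym (vertex-trans αρ-at-R (vertex r))))
  up-unique up-R up-R r = refl
  up-unique up-R up-G r = ⊥-elim (G≁R (vertex-sym (vertex-trans αρ-at-R (vertex r))))
  up-unique up-G (up-inner ¬o l) r = ⊥-elim (proj₁ (proj₂ (up-inner-vertex ¬o l)) (vertex-sym (vertex r)))
  up-unique up-G up-R r = ⊥-elim (G≁R (vertex-trans (vertex r) (vertex-sym αρ-at-R)))
  up-unique up-G up-G r = refl

  module Primal = Contour α σ π α-invol σ-perm π-injective Tree Tree? π-along π-turn Up up-tree
    (λ u → tree-α (up-tree u)) tree-up up-asym up-unique ρ (λ r → up⇒not-at-B (vertex r))

  -- Each inner face has a unique edge between its red and its green corner, and this edge is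
  -- green, red or {u_G , u_R}.  Crossing it directs the dual of the complement of Tree towards
  -- the outer face.
  Exit : Fin k → Set
  Exit d = ¬ Tree d × cc d ≡ green

  exit⇒inner : ∀ {d} → Exit d → ¬ OuterCorner d
  exit⇒inner (¬t , e) at₀ with () ← trans (sym e) (cc-B vertex-refl)
  exit⇒inner (¬t , e) at₁ = ¬t (from-G refl)
  exit⇒inner (¬t , e) at₂ with () ← trans (sym e) (cc-R vertex-refl)

  cotree-exit : ∀ {d} → ¬ Tree d → Exit d ⊎ Exit (α d)
  cotree-exit {d} ¬t = by-cases (outerDart? d)
    where
    ¬t′ : ¬ Tree (α d)
    ¬t′ t = ¬t (tree-α⁻ t)
    inner-case : ¬ OuterDart d → ∀ l → Lab d ≡ l → Exit d ⊎ Exit (α d)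
    inner-case ¬o (b     , blue)  e = ⊥-elim (¬t (tree (inj₁ (¬o , cong proj₂ e))))
    inner-case ¬o (true  , green) e = inj₂ (¬t′ , trans (cc-inner (inner-α ¬o)) (cong cornerAfter (Lab-α ¬o e)))
    inner-case ¬o (false , green) e = inj₁ (¬t , trans (cc-inner ¬o) (cong cornerAfter e))
    inner-case ¬o (true  , red)   e = inj₁ (¬t , trans (cc-inner ¬o) (cong cornerAfter e))
    inner-case ¬o (false , red)   e = inj₂ (¬t′ , trans (cc-inner (inner-α ¬o)) (cong cornerAfter (Lab-α ¬o e)))
    outer-exit : OuterCase d → Exit d ⊎ Exit (α d)
    outer-exit oB  = ⊥-elim (¬t (tree (inj₂ (inj₁ refl))))
    outer-exit oG  = ⊥-elim (¬t (from-G refl))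
    outer-exit oR  = inj₂ (¬t′ , trans (cong cc α-dR) (cc-G vertex-σ))
    outer-exit oσB = ⊥-elim (¬t (to-G refl))
    outer-exit oσG = inj₁ (¬t , cc-G vertex-σ)
    outer-exit oσR = ⊥-elim (¬t (tree (inj₂ (inj₂ (sym α-dB)))))
    by-cases : Dec (OuterDart d) → Exit d ⊎ Exit (α d)
    by-cases (yes o) = outer-exit (outer-case o)
    by-cases (no ¬o) = inner-case ¬o (Lab d) refl

  -- For an inner edge of colour `c`, the corners after its two darts are coloured `c` and `next c`,
  -- which differ. For {u_G , u_R} one of the two darts is a corner of the outer face.
  exit-asym : ∀ {d} → Exit d → ¬ Exit (α d)
  exit-asym {d} x@(¬t , e) (¬t′ , e′) = by-cases (outerDart? d)
    where
    inner-case : ¬ OuterDart d → ∀ l → Lab d ≡ l → ⊥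
    inner-case ¬o l el = clash l (trans (sym (trans (cc-inner ¬o) (cong cornerAfter el))) e)
                           (trans (sym (trans (cc-inner (inner-α ¬o)) (cong cornerAfter (Lab-α ¬o el)))) e′)
      where
      clash : ∀ l → cornerAfter l ≡ green → cornerAfter (not (proj₁ l) , proj₂ l) ≡ green → ⊥
      clash (true  , red)   _ ()
      clash (true  , green) ()
      clash (true  , blue)  ()
      clash (false , red)   ()
      clash (false , green) _ ()
      clash (false , blue)  ()
    outer-exit : ∀ {d} → OuterCase d → Exit d → Exit (α d) → ⊥
    outer-exit oB  x y = proj₁ x (tree (inj₂ (inj₁ refl)))
    outer-exit oG  x y = proj₁ x (from-G refl)
    outer-exit oR  x y = exit⇒inner x at₂
    outer-exit oσB x y = proj₁ x (to-G refl)
    outer-exit oσG x y = exit⇒inner y at₂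
    outer-exit oσR x y = proj₁ x (tree (inj₂ (inj₂ (sym α-dB))))
    by-cases : Dec (OuterDart d) → ⊥
    by-cases (yes o) = outer-exit (outer-case o) x (¬t′ , e′)
    by-cases (no ¬o) = inner-case ¬o (Lab d) refl

  exit-unique : ∀ {d d′} → Exit d → Exit d′ → Reaches φ d d′ → d ≡ d′
  exit-unique x x′ r = same-colour (exit⇒inner x) (face⁻ r) (trans (proj₂ x) (sym (proj₂ x′)))

  -- The dual map keeps `α` and rotates by `φ`. As `α (φ d)` is `σ d`, following a dual edge is the
  -- same as turning around a vertex, so one and the same `π` walks around both subgraphs.
  module Dual = Contour α φ π α-invol φ-injective π-injective (λ d → ¬ Tree d) (λ d → ¬? (Tree? d))
    (λ d ¬t → trans (π-turn d (λ t → ¬t (tree-α t))) (sym (α-invol (σ d))))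
    (λ d ¬¬t → π-along d (tree-α⁻ (decidable-stable (Tree? (φ d)) ¬¬t)))
    Exit proj₁ (λ x t → proj₁ x (tree-α⁻ t)) cotree-exit exit-asym exit-unique ρ
    (λ r x → exit⇒inner x (face⁻ r))

  opaque
    walk-covers : ∀ d → Reaches π ρ d
    walk-covers d = along (connected ρ d) reaches-refl
      where
      along : ∀ {x y} → Star Adj x y → Reaches π ρ x → Reaches π ρ y
      along ε r = r
      along (inj₁ refl ◅ s) r = along s (Primal.orbit-rotate r (1 , refl))
      -- If `σ z` is `x`, then `α x` is `φ z`: a step back by `σ` inside the vertex, then a step by
      -- `φ` inside the face.
      along {x} (inj₂ refl ◅ s) r with Oσ.preimage x
      ... | z , refl , t = along s (Dual.orbit-rotate {z} (Primal.orbit-rotate r t) (1 , refl))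

-- List searches and orbit representatives

headOr-filter : {A : Set} {P : A → Set} (P? : ∀ x → Dec (P x)) (f : ℕ → A) (dflt : A) (g : ℕ → ℕ) (n j : ℕ) → j < n →
                P (f (g j)) → (∀ i → i < j → ¬ P (f (g i))) →
                headOr dflt (filter P? (map f (applyUpTo g n))) ≡ f (g j)
headOr-filter P? f dflt g (suc n) zero    _   p _ with P? (f (g 0))
... | yes _ = refl
... | no ¬p = ⊥-elim (¬p p)
headOr-filter P? f dflt g (suc n) (suc j) j<n p before with P? (f (g 0))
... | yes q = ⊥-elim (before 0 (s≤s z≤n) q)
... | no _  = headOr-filter P? f dflt (g ∘ suc) n j (s≤s⁻¹ j<n) p (λ i i<j → before (suc i) (s≤s i<j))

length-≡ : {A : Set} {xs ys : List A} → Unique xs → Unique ys →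
           (∀ {x} → x ∈ xs → x ∈ ys) → (∀ {x} → x ∈ ys → x ∈ xs) → length xs ≡ length ys
length-≡ u v ⊆ ⊇ = ≤-antisym
  (length-≤ {R = _≡_} u (λ {x} i → x , ⊆ i , refl) (λ _ _ e e′ → trans e (sym e′)))
  (length-≤ {R = _≡_} v (λ {x} i → x , ⊇ i , refl) (λ _ _ e e′ → trans e (sym e′)))

orbit-min : ∀ {k} {f : Fin k → Fin k} → Injective _≡_ _≡_ f → ∀ x →
            Σ (Fin k) λ z → Reaches f x z × (∀ {w} → Reaches f x w → toℕ z ≤ toℕ w)
orbit-min {k} {f} inj x with least dec (toℕ x) (x , reaches-refl , refl)
  where
  open Orbit inj
  P : ℕ → Set
  P m = Σ (Fin k) λ z → Reaches f x z × toℕ z ≡ m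
  dec : ∀ m → Dec (P m)
  dec m with any? (λ i → toℕ (iter f (toℕ i) x) ≟ m)
  ... | yes (i , e) = yes (_ , (toℕ i , refl) , e)
  ... | no ¬p = no λ { (z , r , e) → let (i , ei) = reaches-bounded r in ¬p (i , trans (cong toℕ ei) e) }
... | m , _ , (z , r , refl) , before = z , r , λ {w} s → ≮⇒≥ λ lt → before (toℕ w) lt (w , s , refl)

-- The contour of the blue tree as a cycle of darts

module ContourList {k : ℕ} (M : Map k) (tri : IsRootedTriangulation M)
                   (W : Wood k) (wood : WoodOps.IsSchnyderWood M W) where

  open Spanning M tri W wood
  open SchnyderWood M tri W wood
  open IsRootedTriangulation tri
  open IsSchnyderWood wood

  -- The specification of `firstTree` without its search bound `k` and its default value.
  FirstTree : Fin k → Fin k → Set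
  FirstTree x y = Σ ℕ λ j → iter σ j x ≡ y × TreeDart y × (∀ i → i < j → ¬ TreeDart (iter σ i x))

  first-here : ∀ {x} → TreeDart x → FirstTree x x
  first-here t = 0 , refl , t , λ _ ()

  first-later : ∀ {x y} → ¬ TreeDart x → FirstTree (σ x) y → FirstTree x y
  first-later {x} ¬t (j , e , t , before) = suc j , trans (sym (iter-shift σ j x)) e , t ,
    λ { zero _ → ¬t ; (suc i) i<j u → before i (s≤s⁻¹ i<j) (subst TreeDart (sym (iter-shift σ i x)) u) }

  first-tree≡ : ∀ {x y} → FirstTree x y → firstTree x ≡ y
  first-tree≡ {x} (j , refl , t , before) with Oσ.reaches-bounded {x} (j , refl)
  ... | i , e with least (λ l → treeDart? (iter σ l x)) (toℕ i) (subst TreeDart (sym e) t)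
  ...   | l , l≤i , tl , before′ = trans (headOr-filter treeDart? (λ j → iter σ j x) x id k l (≤-<-trans l≤i (toℕ<n i)) tl before′)
            (cong (λ m → iter σ m x) l≡j)
    where
    l≡j : l ≡ j
    l≡j with <-cmp l j
    ... | tri< l<j _ _ = ⊥-elim (before l l<j tl)
    ... | tri≈ _ e _   = e
    ... | tri> _ _ j<l = ⊥-elim (before′ j j<l t)

  first-exists : ∀ {x y} → SameVertex x y → TreeDart y → FirstTree x (firstTree x)
  first-exists {x} (i , e) t with least (λ l → treeDart? (iter σ l x)) (toℕ i) (subst TreeDart (sym e) t)
  ... | l , _ , tl , before = subst (FirstTree x) (sym (first-tree≡ f)) f
    where f : FirstTree x (iter σ l x)
          f = l , refl , tl , before

  first-vertex : ∀ {x y} → FirstTree x y → SameVertex x y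
  first-vertex (j , e , _) = vertex (j , e)

  first-tree : ∀ {x y} → FirstTree x y → TreeDart y
  first-tree (_ , _ , t , _) = t

  tree-ρ : TreeDart ρ
  tree-ρ = inj₂ (inj₁ refl)

  tree-αρ : TreeDart (α ρ)
  tree-αρ = inj₂ (inj₂ refl)

  tree⇒not-at-G : ∀ {d} → TreeDart d → ¬ SameVertex dG d
  tree⇒not-at-G (inj₁ (¬o , e)) s with () ← trans (sym e) (cong proj₂ (at-uG _ ¬o s))
  tree⇒not-at-G (inj₂ (inj₁ refl)) s = B≁G (vertex-sym s)
  tree⇒not-at-G (inj₂ (inj₂ refl)) s = G≁R (vertex-trans s (vertex-sym αρ-at-R))

  tree-at-R : ∀ {d} → TreeDart d → SameVertex dR d → d ≡ α ρ
  tree-at-R (inj₁ (¬o , e)) s with () ← trans (sym e) (cong proj₂ (at-uR _ ¬o s))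
  tree-at-R (inj₂ (inj₁ refl)) s = ⊥-elim (B≁R (vertex-sym s))
  tree-at-R (inj₂ (inj₂ e)) s = e

  ¬tree-σρ : ¬ TreeDart (σ ρ)
  ¬tree-σρ t = tree⇒not-at-G (treeDart-α t) vertex-refl

  ¬tree-dG : ¬ TreeDart dG
  ¬tree-dG t = tree⇒not-at-G t vertex-refl

  tree-dart-at : ∀ x → ¬ SameVertex dG x → Σ (Fin k) λ y → SameVertex x y × TreeDart y
  tree-dart-at x ¬g with vertex-case x
  ... | atB s = ρ , vertex-sym s , tree-ρ
  ... | atG s = ⊥-elim (¬g s)
  ... | atR s = α ρ , vertex-trans (vertex-sym s) αρ-at-R , tree-αρ
  ... | inner i with out-blue i
  ...   | o , s , e = o , s , inj₁ (inner-vertex⇒inner (inner-vertex-resp s i) , cong proj₂ e)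

  opaque
    -- Every vertex other than u_G meets T_blue, so the default value of `firstTree` is never
    -- returned there.
    first-at : ∀ x → ¬ SameVertex dG x → FirstTree x (firstTree x)
    first-at x ¬g with tree-dart-at x ¬g
    ... | y , s , t = first-exists s t

  first-skip : ∀ {x} → ¬ SameVertex dG x → ¬ TreeDart x → firstTree x ≡ firstTree (σ x)
  first-skip {x} ¬g ¬t = first-tree≡ (first-later ¬t (first-at (σ x) λ s → ¬g (vertex-trans s (vertex-sym vertex-σ))))

  opaque
    τ : Fin k → Fin k
    τ e = firstTree (σ (α e))

  opaque
    unfolding τ

    τ-def : ∀ e → τ e ≡ firstTree (σ (α e))
    τ-def e = refl

    tree-τ : ∀ {e} → TreeDart e → FirstTree (σ (α e)) (τ e)
    tree-τ t = first-at _ λ s → tree⇒not-at-G (treeDart-α t) (vertex-trans s (vertex-sym vertex-σ))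

    τ-αρ : τ (α ρ) ≡ firstTree (σ ρ)
    τ-αρ = cong (λ z → firstTree (σ z)) (α-invol ρ)

  -- u_R is a leaf of T_blue, its inner edges being red.
  τ-ρ : τ ρ ≡ α ρ
  τ-ρ = tree-at-R (first-tree f) (vertex-trans αρ-at-R (vertex-trans vertex-σ (first-vertex f)))
    where f = tree-τ tree-ρ

  -- The walk around Tree, started after the corner u_B u_G, is the walk around T_blue
  -- interrupted by the corners of u_G.
  walk⇒contour : ∀ i → let d = iter π i (σ ρ) in SameVertex dG d ⊎ Reaches τ (α ρ) (firstTree (σ d))
  walk⇒contour zero = inj₂ (1 , trans τ-αρ (first-skip (λ s → B≁G (vertex-sym (vertex-trans s (vertex-sym vertex-σ)))) ¬tree-σρ))
  walk⇒contour (suc i) = by-cases (sameVertex? dG d) (Tree? (σ d)) (walk⇒contour i)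
    where
    d = iter π i (σ ρ)
    Goal = SameVertex dG (π d) ⊎ Reaches τ (α ρ) (firstTree (σ (π d)))
    start : SameVertex dG (σ ρ) ⊎ Reaches τ (α ρ) (firstTree (σ (σ ρ)))
    start = walk⇒contour zero
    at-G : SameVertex dG d → Tree (σ d) → Goal
    at-G s (tree t)   = ⊥-elim (tree⇒not-at-G t (vertex-trans s vertex-σ))
    at-G s (to-G e)   = ⊥-elim (B≁G (vertex-sym (vertex-trans s (subst (SameVertex d) (σ-perm e) vertex-refl))))
    -- Leaving u_G leads back to the corner `σ ρ`, for which the claim is the case of zero steps.
    at-G s (from-G e) = subst (λ z → SameVertex dG z ⊎ Reaches τ (α ρ) (firstTree (σ z)))
      (sym (trans (π-along d (from-G e)) (trans (cong α e) α-dG))) start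
    along : ¬ SameVertex dG d → Reaches τ (α ρ) (firstTree (σ d)) → Tree (σ d) → Goal
    along ¬s r (tree t) = inj₂ (subst (λ z → Reaches τ (α ρ) (firstTree (σ z))) (sym (π-along d (tree t)))
      (subst (Reaches τ (α ρ)) (trans (cong τ (first-tree≡ (first-here t))) (τ-def (σ d))) (reaches-step r)))
    along ¬s r (to-G e) = inj₁ (subst (SameVertex dG) (sym (trans (π-along d (to-G e)) (cong α e))) vertex-refl)
    along ¬s r (from-G e) = ⊥-elim (¬s (vertex-sym (subst (SameVertex d) e vertex-σ)))
    by-cases : Dec (SameVertex dG d) → Dec (Tree (σ d)) → SameVertex dG d ⊎ Reaches τ (α ρ) (firstTree (σ d)) → Goal
    by-cases (yes s) (yes t) _        = at-G s t
    by-cases (yes s) (no ¬t) _        = inj₁ (subst (SameVertex dG) (sym (π-turn d ¬t)) (vertex-trans s vertex-σ))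
    by-cases (no ¬s) _       (inj₁ s) = ⊥-elim (¬s s)
    by-cases (no ¬s) (yes t) (inj₂ r) = along ¬s r t
    by-cases (no ¬s) (no ¬t) (inj₂ r) = inj₂ (subst (Reaches τ (α ρ))
      (trans (first-skip (λ s → ¬s (vertex-trans s (vertex-sym vertex-σ))) (λ t → ¬t (tree t)))
             (cong (λ z → firstTree (σ z)) (sym (π-turn d ¬t)))) r)

  opaque
    tree-dart-in-contour : ∀ {e} → TreeDart e → Reaches τ (α ρ) e
    tree-dart-in-contour {e} t with Oσ.preimage e
    ... | d , refl , _ with reaches-trans (Orbit.reaches-sym π-injective (walk-covers (σ ρ))) (walk-covers d)
    ...   | i , refl with walk⇒contour i
    ...     | inj₁ s = ⊥-elim (tree⇒not-at-G t (vertex-trans s vertex-σ))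
    ...     | inj₂ r = subst (Reaches τ (α ρ)) (first-tree≡ (first-here t)) r

  -- Started at the dart from u_R to u_B, so that `t 1` is the first step of the contour and `ρ`
  -- comes last before the return.
  t : ℕ → Fin k
  t i = iter τ i (α ρ)

  tree-t : ∀ i → TreeDart (t i)
  tree-t zero    = tree-αρ
  tree-t (suc i) = first-tree (tree-τ (tree-t i))

  opaque
    first-return : Σ ℕ λ p → t (suc p) ≡ α ρ × (∀ i → i < p → t (suc i) ≢ α ρ)
    first-return with tree-dart-in-contour tree-ρ
    ... | i , e with least (λ j → t (suc j) ≟F α ρ) i (trans (cong τ e) τ-ρ)
    ...   | p , _ , ep , before = p , ep , before

  opaque
    p : ℕ
    p = proj₁ first-return

    t-period : t (suc p) ≡ α ρ
    t-period = proj₁ (proj₂ first-return)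

    t-before : ∀ i → i < p → t (suc i) ≢ α ρ
    t-before = proj₂ (proj₂ first-return)

  -- Advance both terms until the index `j` becomes `suc p`: the other index then gives a return to
  -- `α ρ` before the first one.
  t-distinct : ∀ {i j} → i < j → j < suc p → t i ≢ t j
  t-distinct {i} {j} i<j j≤p e with m≤n⇒∃[o]m+o≡n (s≤s⁻¹ j≤p)
  ... | o , j+o = t-before (o + i) (≤-trans (≤-reflexive (sym (+-suc o i))) (≤-trans (+-monoʳ-≤ o i<j) (≤-reflexive (trans (+-comm o j) j+o))))
    (begin
      t (suc (o + i))          ≡⟨ iter-+ τ (suc o) i (α ρ) ⟩
      iter τ (suc o) (t i)     ≡⟨ cong (iter τ (suc o)) e ⟩
      iter τ (suc o) (t j)     ≡⟨ sym (iter-+ τ (suc o) j (α ρ)) ⟩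
      t (suc (o + j))          ≡⟨ cong (λ l → t (suc l)) (trans (+-comm o j) j+o) ⟩
      t (suc p)                ≡⟨ t-period ⟩
      α ρ                      ∎)
    where open ≡-Reasoning

  opaque
    t-covers : ∀ {e} → TreeDart e → Σ ℕ λ i → i < suc p × t i ≡ e
    t-covers u with tree-dart-in-contour u
    ... | m , e = m % suc p , m%n<n m (suc p) , trans (iter-% τ (suc p) t-period m) e

  -- As `τ ρ` is `α ρ`, an earlier occurrence of `ρ` would bring an earlier return.
  t-p : t p ≡ ρ
  t-p with t-covers tree-ρ
  ... | i , i≤p , e with m≤n⇒m<n∨m≡n (s≤s⁻¹ i≤p)
  ...   | inj₁ i<p = ⊥-elim (t-before i i<p (trans (cong τ e) τ-ρ))
  ...   | inj₂ refl = e

  Up? : ∀ d → Dec (Up d)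
  Up? d with Tree? d
  ... | no ¬t = no λ u → ¬t (up-tree u)
  ... | yes s with tree-up s
  ...   | inj₁ u = yes u
  ...   | inj₂ u = no λ u′ → up-asym u′ u

  ups : List (Fin k)
  ups = filter Up? (allFin k)

  ups-unique : Unique ups
  ups-unique = Unique.filter⁺ Up? (Unique.allFin⁺ k)

  ∈-ups : ∀ {d} → Up d → d ∈ ups
  ∈-ups u = ∈-filter⁺ Up? (∈-allFin _) u

  ∈-ups⁻ : ∀ {d} → d ∈ ups → Up d
  ∈-ups⁻ i = proj₂ (∈-filter⁻ Up? {xs = allFin k} i)

  up-at : ∀ x → ¬ SameVertex dB x → Σ (Fin k) λ o → SameVertex x o × Up o
  up-at x ¬b with vertex-case x
  ... | atB s = ⊥-elim (¬b s)
  ... | atG s = dG , vertex-sym s , up-G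
  ... | atR s = α ρ , vertex-trans (vertex-sym s) αρ-at-R , up-R
  ... | inner i with out-blue i
  ...   | o , s , e = o , s , up-inner (inner-vertex⇒inner (inner-vertex-resp s i)) e

  vertices : List (Fin k)
  vertices = filter (isOrbitMin? σ) (allFin k)

  IsMin : Fin k → Set
  IsMin = IsOrbitMin σ

  ∈-vertices⁻ : ∀ {x} → x ∈ vertices → IsMin x
  ∈-vertices⁻ i = proj₂ (∈-filter⁻ (isOrbitMin? σ) {xs = allFin k} i)

  mins-equal : ∀ {x y} → IsMin x → IsMin y → SameVertex x y → x ≡ y
  mins-equal mx my s with s | vertex-sym s
  ... | i , e | j , e′ = toℕ-injective (≤-antisym (subst (_ ≤_) (cong toℕ e) (mx i)) (subst (_ ≤_) (cong toℕ e′) (my j)))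

  -- `ρ` stands in for u_B, the only vertex without a dart of `Up`.
  vertices-ups : length vertices ≡ suc (length ups)
  vertices-ups = ≤-antisym
    (length-≤ {R = SameVertex} {ys = ρ ∷ ups} (Unique.filter⁺ (isOrbitMin? σ) (Unique.allFin⁺ k)) (λ {x} _ → represent x)
       λ i j s s′ → mins-equal (∈-vertices⁻ i) (∈-vertices⁻ j) (vertex-trans s (vertex-sym s′)))
    (length-≤ {R = SameVertex} {xs = ρ ∷ ups} (All.tabulate (λ i → λ { refl → up⇒not-at-B vertex-refl (∈-ups⁻ i) }) ∷ ups-unique)
       (λ {x} _ → minimum x) separate)
    where
    represent : ∀ x → Σ (Fin k) λ y → y ∈ ρ ∷ ups × SameVertex x y
    represent x with sameVertex? x ρ
    ... | yes s = ρ , here refl , s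
    ... | no ¬s with up-at x (λ s → ¬s (vertex-sym s))
    ...   | o , s , u = o , there (∈-ups u) , s
    minimum : ∀ x → Σ (Fin k) λ y → y ∈ vertices × SameVertex x y
    minimum x with orbit-min σ-perm x
    ... | z , r , m = z , ∈-filter⁺ (isOrbitMin? σ) (∈-allFin z) (λ i → m (reaches-trans r (toℕ i , refl))) , vertex r
    separate : ∀ {x x′ y} → x ∈ ρ ∷ ups → x′ ∈ ρ ∷ ups → SameVertex x y → SameVertex x′ y → x ≡ x′
    separate (here refl) (here refl) s s′ = refl
    separate (here refl) (there i)   s s′ = ⊥-elim (up⇒not-at-B (vertex-trans s (vertex-sym s′)) (∈-ups⁻ i))
    separate (there i)   (here refl) s s′ = ⊥-elim (up⇒not-at-B (vertex-trans s′ (vertex-sym s)) (∈-ups⁻ i))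
    separate (there i)   (there j)   s s′ = up-unique (∈-ups⁻ i) (∈-ups⁻ j) (vertex⁻ (vertex-trans s (vertex-sym s′)))

  σρ≢dG : σ ρ ≢ dG
  σρ≢dG e = B≁G (subst (SameVertex dB) e vertex-σ)

  -- Both sides count the darts of `Tree`: by the cycle and the two darts of {u_B , u_G}, and by the
  -- darts of `Up` and their opposites.
  cycle-ups : 2 + suc p ≡ length ups + length ups
  cycle-ups = begin
    2 + suc p                           ≡⟨ cong (2 +_) (sym (length-applyUpTo t (suc p))) ⟩
    length cycle                        ≡⟨ length-≡ cycle-unique darts-unique (λ i → tree-∈ (∈-cycle⁻ i)) (λ i → ∈-cycle (∈-darts⁻ i)) ⟩
    length (ups ++ map α ups)           ≡⟨ length-++ ups ⟩
    length ups + length (map α ups)     ≡⟨ cong (length ups +_) (length-map α ups) ⟩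
    length ups + length ups             ∎
    where
    open ≡-Reasoning
    cycle : List (Fin k)
    cycle = σ ρ ∷ dG ∷ applyUpTo t (suc p)
    ¬∈ : ∀ {d} → ¬ TreeDart d → ∀ {x} → x ∈ applyUpTo t (suc p) → d ≢ x
    ¬∈ ¬u i refl with ∈-applyUpTo⁻ t i
    ... | j , _ , refl = ¬u (tree-t j)
    cycle-unique : Unique cycle
    cycle-unique = (σρ≢dG All.∷ All.tabulate (¬∈ ¬tree-σρ)) ∷ All.tabulate (¬∈ ¬tree-dG) ∷ Unique.applyUpTo⁺₁ t (suc p) t-distinct
    darts-unique : Unique (ups ++ map α ups)
    darts-unique = Unique.++⁺ ups-unique (Unique.map⁺ α-injective ups-unique) disjoint
      where
      disjoint : ∀ {v} → v ∈ ups × v ∈ map α ups → ⊥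
      disjoint (i , j) with ∈-map⁻ α j
      ... | w , iw , refl = up-asym (∈-ups⁻ iw) (∈-ups⁻ i)
    ∈-cycle⁻ : ∀ {x} → x ∈ cycle → Tree x
    ∈-cycle⁻ (here e)         = to-G e
    ∈-cycle⁻ (there (here e)) = from-G e
    ∈-cycle⁻ (there (there i)) with ∈-applyUpTo⁻ t i
    ... | j , _ , refl = tree (tree-t j)
    tree-∈ : ∀ {x} → Tree x → x ∈ ups ++ map α ups
    tree-∈ {x} u with tree-up u
    ... | inj₁ v = ∈-++⁺ˡ (∈-ups v)
    ... | inj₂ v = ∈-++⁺ʳ ups (subst (_∈ map α ups) (α-invol x) (∈-map⁺ α (∈-ups v)))
    ∈-darts⁻ : ∀ {x} → x ∈ ups ++ map α ups → Tree x
    ∈-darts⁻ i with ∈-++⁻ ups i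
    ... | inj₁ j = up-tree (∈-ups⁻ j)
    ... | inj₂ j with ∈-map⁻ α j
    ...   | w , iw , refl = tree-α (up-tree (∈-ups⁻ iw))
    ∈-cycle : ∀ {x} → Tree x → x ∈ cycle
    ∈-cycle (to-G e)   = here e
    ∈-cycle (from-G e) = there (here e)
    ∈-cycle (tree u) with t-covers u
    ... | i , i<p , refl = there (there (∈-applyUpTo⁺ t i<p))

  opaque
    unfolding τ

    contourFrom≡ : ∀ s (f : ℕ → Fin k) → (∀ i → f (suc i) ≡ τ (f i)) →
                   contourFrom s (σ (α (f 0))) ≡ applyUpTo (f ∘ suc) s
    contourFrom≡ zero    f e = refl
    contourFrom≡ (suc s) f e = cong₂ _∷_ (sym (e 0))
      (trans (cong (λ z → contourFrom s (σ (α z))) (sym (e 0))) (contourFrom≡ s (f ∘ suc) (e ∘ suc)))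

    contour≡ : ∀ n → contour n ≡ applyUpTo (t ∘ suc) (2 * n)
    contour≡ n = trans (cong (λ z → contourFrom (2 * n) (σ z)) (sym (α-invol ρ))) (contourFrom≡ (2 * n) t λ _ → refl)

-- Splitting lists

split-lookup : {A : Set} (xs : List A) (i : Fin (length xs)) →
               Σ (List A) λ u → Σ (List A) λ v → xs ≡ u ++ lookup xs i ∷ v × length u ≡ toℕ i
split-lookup (x ∷ xs) Fin.zero    = [] , xs , refl , refl
split-lookup (x ∷ xs) (Fin.suc i) with split-lookup xs i
... | u , v , e , l = x ∷ u , v , cong (x ∷_) e , cong suc l

filterᵇ-accept : {A : Set} (q : A → Bool) {x : A} {xs : List A} → q x ≡ true → filterᵇ q (x ∷ xs) ≡ x ∷ filterᵇ q xs
filterᵇ-accept q e rewrite e = refl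

filterᵇ-reject : {A : Set} (q : A → Bool) {x : A} {xs : List A} → q x ≡ false → filterᵇ q (x ∷ xs) ≡ filterᵇ q xs
filterᵇ-reject q e rewrite e = refl

split-filterᵇ : {A : Set} (q : A → Bool) (xs : List A) {u : List A} {x : A} {v : List A} → filterᵇ q xs ≡ u ++ x ∷ v →
                Σ (List A) λ u′ → Σ (List A) λ v′ →
                xs ≡ u′ ++ x ∷ v′ × filterᵇ q u′ ≡ u × filterᵇ q v′ ≡ v × q x ≡ true
split-filterᵇ q [] {[]} ()
split-filterᵇ q [] {_ ∷ _} ()
split-filterᵇ q (x ∷ xs) {u} e with q x in qx
split-filterᵇ q (x ∷ xs) {[]} refl | true = [] , xs , refl , refl , refl , qx
split-filterᵇ q (x ∷ xs) {_ ∷ u} e | true with ∷-injective e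
... | refl , e′ with split-filterᵇ q xs e′
...   | u′ , v′ , e₁ , e₂ , e₃ , e₄ =
        x ∷ u′ , v′ , cong (x ∷_) e₁ , trans (filterᵇ-accept q qx) (cong (x ∷_) e₂) , e₃ , e₄
split-filterᵇ q (x ∷ xs) {u} e | false with split-filterᵇ q xs {u} e
... | u′ , v′ , e₁ , e₂ , e₃ , e₄ =
        x ∷ u′ , v′ , cong (x ∷_) e₁ , trans (filterᵇ-reject q qx) e₂ , e₃ , e₄

filterᵇ-++ : {A : Set} (q : A → Bool) (xs ys : List A) → filterᵇ q (xs ++ ys) ≡ filterᵇ q xs ++ filterᵇ q ys
filterᵇ-++ q xs ys = filter-++ (λ x → T? (q x)) xs ys

split-applyUpTo : {A : Set} (f : ℕ → A) (m : ℕ) (u : List A) {e : A} {v : List A} → applyUpTo f m ≡ u ++ e ∷ v →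
                  e ≡ f (length u) × (m ≡ suc (length u) ⊎ Σ (List A) λ v′ → v ≡ f (suc (length u)) ∷ v′)
split-applyUpTo f (suc zero)    []      refl = refl , inj₁ refl
split-applyUpTo f (suc (suc m)) []      refl = refl , inj₂ (_ , refl)
split-applyUpTo f zero          (_ ∷ u) ()
split-applyUpTo f (suc m)       (_ ∷ u) e with split-applyUpTo (f ∘ suc) m u (proj₂ (∷-injective e))
... | e₁ , inj₁ e₂ = e₁ , inj₁ (cong suc e₂)
... | e₁ , inj₂ e₂ = e₁ , inj₂ e₂

applyUpTo-split : {A : Set} (f : ℕ → A) {m i : ℕ} → suc i < m →
                  Σ (List A) λ u → Σ (List A) λ v → applyUpTo f m ≡ u ++ f i ∷ f (suc i) ∷ v
applyUpTo-split f {suc zero} (s≤s ())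
applyUpTo-split f {suc (suc m)} {zero} _ = [] , _ , refl
applyUpTo-split f {suc m} {suc i} lt with applyUpTo-split (f ∘ suc) {m} {i} (s≤s⁻¹ lt)
... | u , v , e = f 0 ∷ u , v , cong (f 0 ∷_) e

split-map-snoc : {A B : Set} (f : A → B) (xs : List A) {z : B} (u : List B) {x y : B} {v : List B} →
                 map f xs ++ z ∷ [] ≡ u ++ x ∷ y ∷ v →
                 Σ (List A) λ u′ → Σ A λ a → Σ (List A) λ v′ →
                 xs ≡ u′ ++ a ∷ v′ × x ≡ f a × length u′ ≡ length u × y ∷ v ≡ map f v′ ++ z ∷ []
split-map-snoc f [] [] ()
split-map-snoc f [] (_ ∷ []) ()
split-map-snoc f [] (_ ∷ _ ∷ _) ()
split-map-snoc f (a ∷ xs) [] e = [] , a , xs , refl , sym (proj₁ (∷-injective e)) , refl , sym (proj₂ (∷-injective e))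
split-map-snoc f (a ∷ xs) (_ ∷ u) e with split-map-snoc f xs u (proj₂ (∷-injective e))
... | u′ , b , v′ , e₁ , e₂ , e₃ , e₄ = a ∷ u′ , b , v′ , cong (a ∷_) e₁ , e₂ , cong suc e₃ , e₄

unique-head : {A : Set} {e : A} {xs : List A} → Unique (e ∷ xs) → ¬ e ∈ xs
unique-head (a ∷ _) i = All.lookup a i refl

unique-predecessor : {A : Set} {xs : List A} → Unique xs → ∀ u u′ {p p′ e : A} {v v′} →
                     xs ≡ u ++ p ∷ e ∷ v → xs ≡ u′ ++ p′ ∷ e ∷ v′ → p ≡ p′
unique-predecessor un [] [] refl refl = refl
unique-predecessor (_ ∷ un) [] (_ ∷ []) refl refl = ⊥-elim (unique-head un (here refl))
unique-predecessor (_ ∷ un) [] (_ ∷ _ ∷ u′) refl refl = ⊥-elim (unique-head un (∈-++⁺ʳ u′ (there (here refl))))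
unique-predecessor (_ ∷ un) (_ ∷ []) [] refl refl = ⊥-elim (unique-head un (here refl))
unique-predecessor (_ ∷ un) (_ ∷ _ ∷ u) [] refl refl = ⊥-elim (unique-head un (∈-++⁺ʳ u (there (here refl))))
unique-predecessor (_ ∷ un) (_ ∷ u) (_ ∷ u′) refl e = unique-predecessor un u u′ refl (proj₂ (∷-injective e))

unique-first : {A : Set} {e : A} {xs : List A} → Unique (e ∷ xs) → ∀ u {p : A} {v} → e ∷ xs ≢ u ++ p ∷ e ∷ v
unique-first un [] refl = unique-head un (here refl)
unique-first un (_ ∷ u) refl = unique-head un (∈-++⁺ʳ u (there (here refl)))

lookup-from-split : {A : Set} (P : A → ℕ → Set) (xs : List A) →
                    (∀ u {y v} → xs ≡ u ++ y ∷ v → P y (length u)) → ∀ i → P (lookup xs i) (toℕ i)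
lookup-from-split P xs h i with split-lookup xs i
... | u , v , e , l = subst (P (lookup xs i)) l (h u e)

∈⇒lookup-cast : {A : Set} {xs : List A} {m : ℕ} (eq : length xs ≡ m) {y : A} → y ∈ xs →
               Σ (Fin m) λ r → lookup xs (cast (sym eq) r) ≡ y
∈⇒lookup-cast {xs = xs} eq y∈ = cast eq (index y∈) , trans
  (cong (lookup xs) (toℕ-injective (trans (toℕ-cast (sym eq) (cast eq (index y∈))) (toℕ-cast eq (index y∈)))))
  (sym (lookup-index y∈))

-- Canopy words

exponents-∷ : ∀ w → Σ ℕ λ a → Σ (List ℕ) λ as → exponents w ≡ a ∷ as
exponents-∷ []      = 0 , [] , refl
exponents-∷ (N ∷ w) = 0 , exponents w , refl
exponents-∷ (E ∷ w) with exponents-∷ w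
... | a , as , e = suc a , as , cong incHead e

can-E-zero : ∀ w → nth (can (E ∷ w)) 0 ≡ N
can-E-zero w with exponents w | exponents-∷ w
... | _ | a , as , refl = refl

can-E-suc : ∀ w r → nth (can (E ∷ w)) (suc r) ≡ nth (can w) (suc r)
can-E-suc w r with exponents w
... | []     = refl
... | _ ∷ _  = refl

exponents-concat : {A : Set} (f : A → ℕ) (xs : List A) →
                   exponents (concatMap (λ x → N ∷ replicate (f x) E) xs) ≡ 0 ∷ map f xs
exponents-concat f []       = refl
exponents-concat f (x ∷ xs) = cong (0 ∷_) (trans (run (f x) _ (exponents-concat f xs)) (cong (_∷ map f xs) (+-identityʳ (f x))))
  where
  run : ∀ b w {a as} → exponents w ≡ a ∷ as → exponents (replicate b E ++ w) ≡ b + a ∷ as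
  run zero    w e = e
  run (suc b) w e = cong incHead (run b w e)

nth-map-map : {A : Set} (f : A → ℕ) (u : List A) {x : A} {v : List A} →
              nth (map canLetter (map f (u ++ x ∷ v))) (length u) ≡ canLetter (f x)
nth-map-map f []      = refl
nth-map-map f (_ ∷ u) = nth-map-map f u

drop-first : {A : Set} (u : List A) {x y : A} {v : List A} →
             Σ (List A) λ u′ → drop 1 (u ++ x ∷ y ∷ v) ≡ u′ ++ y ∷ v × length u′ ≡ length u
drop-first []      = [] , refl , refl
drop-first (_ ∷ u) {x} = u ++ x ∷ [] , sym (++-assoc u (x ∷ []) _) , trans (length-++ u) (+-comm (length u) 1)

can-length-pos : {A : Set} {P : A → Set} (P? : ∀ x → Dec (P x)) {xs : List A} {x : A} → x ∈ xs → P x →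
                 canLetter (length (filter P? xs)) ≡ N
can-length-pos P? {xs} i p with filter P? xs | ∈-filter⁺ P? i p
... | _ ∷ _ | _ = refl

can-length-zero : {A : Set} {P : A → Set} (P? : ∀ x → Dec (P x)) {xs : List A} → (∀ x → ¬ P x) →
                  canLetter (length (filter P? xs)) ≡ E
can-length-zero {A} {P} P? {xs} ¬p = empty (filter P? xs) λ i → proj₂ (∈-filter⁻ P? {xs = xs} i)
  where
  empty : ∀ ys → (∀ {x} → x ∈ ys → P x) → canLetter (length ys) ≡ E
  empty []      _ = refl
  empty (y ∷ _) m = ⊥-elim (¬p y (m (here refl)))

-- `n + 2` is the number of darts of `Up`; the right side is `2 + suc p` for `p` equal to
-- `1 + 2 * n`.
double : ∀ n → (n + 2) + (n + 2) ≡ 3 + (1 + 2 * n)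
double = solve-∀

cornerAfter-red : ∀ l → cornerAfter l ≡ red → l ≡ (false , red) ⊎ l ≡ (true , blue)
cornerAfter-red (true  , blue)  e = inj₂ refl
cornerAfter-red (true  , green) ()
cornerAfter-red (true  , red)   ()
cornerAfter-red (false , blue)  ()
cornerAfter-red (false , green) ()
cornerAfter-red (false , red)   e = inj₁ refl

cornerAfter-blue : ∀ l → cornerAfter l ≡ blue → l ≡ (false , blue) ⊎ l ≡ (true , green)
cornerAfter-blue (true  , blue)  ()
cornerAfter-blue (true  , green) e = inj₂ refl
cornerAfter-blue (true  , red)   ()
cornerAfter-blue (false , blue)  e = inj₁ refl
cornerAfter-blue (false , green) ()
cornerAfter-blue (false , red)   ()

applyUpTo-head : {A : Set} (f : ℕ → A) {m : ℕ} → 1 ≤ m → Σ (List A) λ v → applyUpTo f m ≡ f 0 ∷ v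
applyUpTo-head f {suc m} _ = _ , refl

module Positions {k : ℕ} (M : Map k) (tri : IsRootedTriangulation M)
                 (W : Wood k) (wood : WoodOps.IsSchnyderWood M W)
                 (n : ℕ) (1≤n : 1 ≤ n) (card : MapOps.numVertices M ≡ n + 3)
                 (minimal : WoodOps.IsMinimal M W) where

  open ContourList M tri W wood
  open Spanning M tri W wood
  open SchnyderWood M tri W wood
  open IsRootedTriangulation tri
  open IsSchnyderWood wood

  -- The contour list

  ups-length : length ups ≡ n + 2
  ups-length = suc-injective (trans (sym vertices-ups) (trans card (+-suc n 2)))

  p≡ : p ≡ suc (2 * n)
  p≡ = +-cancelˡ-≡ 3 p (suc (2 * n)) (trans cycle-ups (trans (cong₂ _+_ ups-length ups-length) (double n)))

  Blue : Fin k → Set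
  Blue e = ¬ OuterDart e × col e ≡ blue

  c : ℕ → Fin k
  c i = t (suc i)

  c-last : c (2 * n) ≡ ρ
  c-last = trans (cong t (sym p≡)) t-p

  <p : ∀ {i} → i < 2 * n → suc i < p
  <p lt = subst (_ <_) (sym p≡) (s≤s lt)

  -- In the cycle the two darts of {u_B , u_R} have the indices 0 and `p`, just outside the contour.
  c-blue : ∀ {i} → i < 2 * n → Blue (c i)
  c-blue {i} lt with tree-t (suc i)
  ... | inj₁ b        = b
  ... | inj₂ (inj₁ e) = ⊥-elim (t-distinct (<p lt) ≤-refl (trans e (sym t-p)))
  ... | inj₂ (inj₂ e) = ⊥-elim (t-distinct {0} (s≤s z≤n) (s≤s (<⇒≤ (<p lt))) (sym e))

  c-index : ∀ {e} → Blue e → Σ ℕ λ i → i < 2 * n × c i ≡ e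
  c-index {e} b = by-cases (t-covers (inj₁ b))
    where
    before-last : ∀ {i} → c i ≡ e → i < 2 * n ⊎ i ≡ 2 * n → Σ ℕ λ i → i < 2 * n × c i ≡ e
    before-last {i} ei (inj₁ lt) = i , lt , ei
    before-last ei (inj₂ eq) = ⊥-elim (proj₁ b (subst OuterDart (trans (sym (trans (cong c eq) c-last)) ei) (outer oB)))
    by-cases : (Σ ℕ λ i → i < suc p × t i ≡ e) → Σ ℕ λ i → i < 2 * n × c i ≡ e
    by-cases (zero , _ , ei)    = ⊥-elim (proj₁ b (subst OuterDart ei outer-αρ))
    by-cases (suc i , i<p , ei) = before-last ei (m≤n⇒m<n∨m≡n i≤2n)
      where i≤2n = s≤s⁻¹ (subst (suc i ≤_) p≡ (s≤s⁻¹ i<p))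

  contour-unique : Unique (contour n)
  contour-unique = subst Unique (sym (contour≡ n))
    (Unique.applyUpTo⁺₁ c (2 * n) λ i<j j<n → t-distinct (s≤s i<j) (<⇒≤ (s≤s (<p j<n))))

  isDown : Fin k → Bool
  isDown e = not (out e)

  down : List (Fin k)
  down = filterᵇ isDown (contour n)

  down-unique : Unique down
  down-unique = Unique.filter⁺ (λ e → T? (isDown e)) contour-unique

  ∈-down : ∀ {e} → Blue e → out e ≡ false → e ∈ down
  ∈-down {e} b o with c-index b
  ... | i , lt , refl = ∈-filter⁺ (λ e → T? (isDown e))
          (subst (c i ∈_) (sym (contour≡ n)) (∈-applyUpTo⁺ c lt)) (subst (λ b → T (not b)) (sym o) _)

  ∈-down⁻ : ∀ {e} → e ∈ down → Blue e × out e ≡ false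
  ∈-down⁻ {e} i with ∈-filter⁻ (λ e → T? (isDown e)) {xs = contour n} i
  ... | j , isd with ∈-applyUpTo⁻ c (subst (e ∈_) (contour≡ n) j)
  ...   | l , lt , refl = c-blue lt , down-false _ isd
    where
    down-false : ∀ b → T (not b) → b ≡ false
    down-false false _ = refl

  -- The out-blue darts of v₀, …, v_{n-1}, and the dart from u_R to u_B.
  ToParent : Fin k → Set
  ToParent y = y ≡ α ρ ⊎ (Blue y × out y ≡ true)

  to-parent-up : ∀ {y} → ToParent y → Up y
  to-parent-up (inj₁ refl)          = up-R
  to-parent-up (inj₂ ((¬o , e) , o)) = up-inner ¬o (cong₂ _,_ o e)

  blue-α : ∀ {e b} → Blue e → out e ≡ b → Blue (α e) × out (α e) ≡ not b
  blue-α (¬o , e) o = (inner-α ¬o , cong proj₂ l) , cong proj₁ l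
    where l = Lab-α ¬o (cong₂ _,_ o e)

  visit⁻ : ∀ {y} → y ∈ visitDarts n → ToParent y
  visit⁻ i with ∈-++⁻ (map α down) i
  ... | inj₂ (here e) = inj₁ e
  ... | inj₁ j with ∈-map⁻ α j
  ...   | e , m , refl = inj₂ (blue-α (proj₁ (∈-down⁻ m)) (proj₂ (∈-down⁻ m)))

  visit : ∀ {y} → ToParent y → y ∈ visitDarts n
  visit (inj₁ refl)     = ∈-++⁺ʳ (map α down) (here refl)
  visit {y} (inj₂ (b , o)) = ∈-++⁺ˡ (subst (_∈ map α down) (α-invol y)
    (∈-map⁺ α (∈-down (proj₁ (blue-α b o)) (proj₂ (blue-α b o)))))

  visit-unique : Unique (visitDarts n)
  visit-unique = Unique.++⁺ (Unique.map⁺ α-injective down-unique) (All.[] ∷ []) disjoint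
    where
    disjoint : ∀ {v} → v ∈ map α down × v ∈ α ρ ∷ [] → ⊥
    disjoint (i , here refl) with ∈-map⁻ α i
    ... | e , m , eq = proj₁ (proj₁ (∈-down⁻ m)) (subst OuterDart (α-injective eq) (outer oB))

  -- With `dG` in front, the list contains every dart of `Up` exactly once.
  visit-length : length (visitDarts n) ≡ suc n
  visit-length = suc-injective (begin
    length (dG ∷ visitDarts n) ≡⟨ length-≡ {xs = dG ∷ visitDarts n} (All.tabulate dG∉ ∷ visit-unique) ups-unique to from ⟩
    length ups                 ≡⟨ ups-length ⟩
    n + 2                      ≡⟨ +-comm n 2 ⟩
    suc (suc n)                ∎)
    where
    open ≡-Reasoning
    dG∉ : ∀ {y} → y ∈ visitDarts n → dG ≢ y
    dG∉ i refl with visit⁻ i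
    ... | inj₁ e = G≁R (subst (λ z → SameVertex z dR) (sym e) (vertex-sym αρ-at-R))
    ... | inj₂ ((¬o , _) , _) = ¬o (outer oG)
    to : ∀ {y} → y ∈ dG ∷ visitDarts n → y ∈ ups
    to (here refl) = ∈-ups up-G
    to (there i)   = ∈-ups (to-parent-up (visit⁻ i))
    from : ∀ {y} → y ∈ ups → y ∈ dG ∷ visitDarts n
    from i with ∈-ups⁻ i
    ... | up-inner ¬o l = there (visit (inj₂ ((¬o , cong proj₂ l) , cong proj₁ l)))
    ... | up-R = there (visit (inj₁ refl))
    ... | up-G = here refl

  -- Darts at the outer vertices

  outer-at-B : ∀ {z} → OuterDart z → SameVertex dB z → z ≡ ρ ⊎ z ≡ σ ρ
  outer-at-B o s with outer-case o
  ... | oB  = inj₁ refl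
  ... | oσB = inj₂ refl
  ... | oG  = ⊥-elim (B≁G s)
  ... | oR  = ⊥-elim (B≁R s)
  ... | oσG = ⊥-elim (B≁G (vertex-trans s (vertex-sym vertex-σ)))
  ... | oσR = ⊥-elim (B≁R (vertex-trans s (vertex-sym vertex-σ)))

  outer-at-R : ∀ {z} → OuterDart z → SameVertex dR z → z ≡ dR ⊎ z ≡ σ dR
  outer-at-R o s with outer-case o
  ... | oR  = inj₁ refl
  ... | oσR = inj₂ refl
  ... | oB  = ⊥-elim (B≁R (vertex-sym s))
  ... | oG  = ⊥-elim (G≁R (vertex-sym s))
  ... | oσB = ⊥-elim (B≁R (vertex-sym (vertex-trans s (vertex-sym vertex-σ))))
  ... | oσG = ⊥-elim (G≁R (vertex-sym (vertex-trans s (vertex-sym vertex-σ))))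

  0<2n : 0 < 2 * n
  0<2n = ≤-trans 1≤n (m≤m+n n (n + 0))

  c-0 : TreeDart (σ (σ ρ)) → c 0 ≡ σ (σ ρ)
  c-0 u = trans τ-αρ (first-tree≡ (first-later ¬tree-σρ (first-here u)))

  -- The contour has a first step because `1 ≤ n`, and that step is an inner edge; if u_B had degree
  -- 2, it would be `ρ`.
  ρ-after-σρ : σ (σ ρ) ≢ ρ
  ρ-after-σρ e = proj₁ (c-blue 0<2n) (subst OuterDart (sym (trans (c-0 (subst TreeDart (sym e) tree-ρ)) e)) (outer oB))

  σσρ-inner : ¬ OuterDart (σ (σ ρ))
  σσρ-inner o with outer-at-B o (vertex (2 , refl))
  ... | inj₁ e = ρ-after-σρ e
  ... | inj₂ e = ¬tree-σρ (subst TreeDart (sym (σ-perm e)) tree-ρ)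

  σσρ-lab : Lab (σ (σ ρ)) ≡ (false , blue)
  σσρ-lab = at-uB _ σσρ-inner (vertex (2 , refl))

  c-0≡ : c 0 ≡ σ (σ ρ)
  c-0≡ = c-0 (inj₁ (σσρ-inner , cong proj₂ σσρ-lab))

  dR≢σdR : dR ≢ σ dR
  dR≢σdR e = B≁G (vertex-sym (vertex-trans vertex-σ (subst (λ z → SameVertex z dB)
    (trans (sym ασdR) (trans (cong α (sym e)) α-dR)) vertex-refl)))

  -- If u_R had degree 2, then so would u_G and u_B.
  dR-after-σdR : σ (σ dR) ≢ dR
  dR-after-σdR e = ρ-after-σρ (trans (cong σ (sym z≡)) σz)
    where
    z = φ (σ dG)
    φσdR : φ (σ dR) ≡ σ dG
    φσdR = trans (cong α e) α-dR
    σz : σ z ≡ ρ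
    σz = α-injective (trans (trans (cong (λ w → φ (φ w)) (sym φσdR)) (φ³ (σ dR))) (sym α-dB))
    -- Both darts go from u_G to u_B, and there are no multiple edges.
    loop : σ (σ dG) ≡ dG
    loop = no-multi _ _ (vertex-sym (vertex (2 , refl)))
      (vertex-trans (subst (SameVertex z) σz vertex-σ) (subst (SameVertex dB) (sym α-dG) vertex-σ))
    z≡ : z ≡ σ dB
    z≡ = trans (cong α loop) α-dG

  -- The face to the right of a dart towards the parent

  module Parent {y : Fin k} (par : ToParent y) where

    inner-or-R : y ≡ α ρ ⊎ (InnerVertex y × Lab y ≡ (true , blue))
    inner-or-R = Sum.map₂ (λ { ((¬o , e) , o) → out⇒inner-vertex ¬o o , cong₂ _,_ o e }) par

    cc-y : cc y ≡ red
    cc-y with inner-or-R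
    ... | inj₁ refl = cc-R αρ-at-R
    ... | inj₂ (i , l) = trans (cc-inner-vertex i) (cong cornerAfter l)

    y-inner : ¬ OuterCorner y
    y-inner at₀ with () ← trans (sym (cc-B vertex-refl)) cc-y
    y-inner at₁ with () ← trans (sym (cc-G vertex-refl)) cc-y
    y-inner at₂ = Sum.[ (λ e → dR≢σdR (trans e α-dB)) , (λ b → proj₁ (proj₁ b) (outer oR)) ] par

    cc-φy : cc (φ y) ≡ green
    cc-φy = trans (cc-φ y-inner) (cong next cc-y)

    cc-φφy : cc (φ (φ y)) ≡ blue
    cc-φφy = trans (cc-φφ y-inner) (cong (λ l → next (next l)) cc-y)

    oriented-y : Oriented y
    oriented-y = Sum.map (λ e → inj₂ (inj₂ (trans e α-dB))) (λ b → proj₁ (proj₁ b) , proj₂ b) par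

    face-y : ∀ {x} → Face y x → SameFace x y
    face-y f = face-sym (face f)

    leg-blue : LegAt y blue
    leg-blue = subst (LegAt y) cc-φφy (leg (face-y at₂) (subst Oriented (sym (φ³ y)) oriented-y))

    leg-red : Oriented (φ y) → LegAt y red
    leg-red o = subst (LegAt y) cc-y (leg (face-y at₀) o)

    leg-red⁻ : LegAt y red → Oriented (φ y)
    leg-red⁻ = leg⇒oriented y-inner cc-y

    leg-green : Oriented (φ (φ y)) → LegAt y green
    leg-green o = subst (LegAt y) cc-φy (leg (face-y at₁) o)

    leg-green⁻ : LegAt y green → Oriented (φ (φ y))
    leg-green⁻ l = leg⇒oriented (inner-φ y-inner) cc-φy (legAt-face (face at₁) l)

    -- At an inner vertex all darts are inner. For the dart from u_R to u_B it matters that u_R does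
    -- not have degree 2.
    σy-inner : ¬ OuterDart (σ y)
    σy-inner o with inner-or-R
    ... | inj₂ (i , _) = σ-inner i o
    ... | inj₁ e with outer-at-R o (vertex-trans αρ-at-R (subst (λ z → SameVertex z (σ y)) e vertex-σ))
    ...   | inj₁ e′ = dR-after-σdR (trans (cong σ (sym (trans e α-dB))) e′)
    ...   | inj₂ e′ = dR≢σdR (trans (sym (σ-perm e′)) (trans e α-dB))

    -- `φ (φ y)` sits at the parent, just before the edge to the child. The green edge of the black
    -- node is a leg when this dart is oriented, which is how first children are recognised.
    before-φφy : σ (φ (φ y)) ≡ α y
    before-φφy = α-injective (trans (φ³ y) (sym (α-invol y)))

  ¬oriented : ∀ {z} → ¬ OuterDart z → out z ≡ false → ¬ Oriented z
  ¬oriented ¬o e (inj₁ u) = ¬o (inj₁ u)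
  ¬oriented ¬o e (inj₂ (_ , o)) with () ← trans (sym e) o

  -- An ingoing red dart is preceded by an ingoing red one or by the outgoing blue `y`. Going back
  -- therefore leads to `y`, whose successor is outgoing green.
  no-red : ∀ {y} → InnerVertex y → Lab y ≡ (true , blue) → Lab (σ y) ≡ (true , green) →
           ∀ i → Lab (iter σ i y) ≢ (false , red)
  no-red v l g zero e with () ← trans (sym l) e
  no-red {y} v l g (suc i) e = by-cases (follows-cc z (σ-inner z-inner))
    where
    z = iter σ i y
    z-inner : InnerVertex z
    z-inner = inner-vertex-resp (vertex (i , refl)) v
    by-lab : Lab z ≡ (false , red) ⊎ Lab z ≡ (true , blue) → ⊥
    by-lab (inj₁ e′) = no-red v l g i e′
    by-lab (inj₂ e′) with () ← trans (sym e) (trans (cong (λ w → Lab (σ w)) (sym (out-blue-unique v (i , refl) l e′))) g)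
    by-cases : Lab (σ z) ≡ (false , cc z) ⊎ Lab (σ z) ≡ (true , next (cc z)) → ⊥
    by-cases (inj₂ e′) with () ← trans (sym e) e′
    by-cases (inj₁ e′) = by-lab (cornerAfter-red (Lab z)
      (trans (sym (cc-inner-vertex z-inner)) (sym (cong proj₂ (trans (sym e) e′)))))

  -- The dart after the red corner alone decides whether `inRed` is zero. At u_R only `some` occurs.
  data RedCase (y : Fin k) : Set where
    some : Lab (σ y) ≡ (false , red) → canLetter (inRed y) ≡ N → RedCase y
    none : InnerVertex y → Lab (σ y) ≡ (true , green) → canLetter (inRed y) ≡ E → RedCase y

  red-case : ∀ {y} → ToParent y → RedCase y
  red-case {y} par = by-cases inner-or-R (follows-cc y σy-inner)
    where
    open Parent par
    by-cases : y ≡ α ρ ⊎ (InnerVertex y × Lab y ≡ (true , blue)) →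
               Lab (σ y) ≡ (false , cc y) ⊎ Lab (σ y) ≡ (true , next (cc y)) → RedCase y
    by-cases _ (inj₁ e) = some e′ (can-length-pos _ (∈-allFin (σ y)) (vertex-σ , σy-inner , cong proj₂ e′ , cong proj₁ e′))
      where e′ : Lab (σ y) ≡ (false , red)
            e′ = trans e (cong (false ,_) cc-y)
    by-cases (inj₁ e) (inj₂ e′) with () ← trans (sym e′) (at-uR (σ y) σy-inner
      (vertex-trans αρ-at-R (subst (λ z → SameVertex z (σ y)) e vertex-σ)))
    by-cases (inj₂ (i , l)) (inj₂ e) = none i e′
      (can-length-zero _ {allFin k} λ { z (s , _ , r , o) → let (j , ez) = vertex⁻ s in
         no-red i l e′ j (trans (cong Lab ez) (cong₂ _,_ o r)) })
      where e′ : Lab (σ y) ≡ (true , green)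
            e′ = trans e (cong (λ l → true , next l) cc-y)

  -- Canopy letters of the two walks

  letter-N : ∀ {e} → out e ≡ false → letter e ≡ N
  letter-N o rewrite o = refl

  letter-E : ∀ {e} → out e ≡ true → letter e ≡ E
  letter-E o rewrite o = refl

  -- The exponent after a North step is positive iff the next letter is `E`, and a positive exponent
  -- has canopy letter `N`: hence the swap.
  afterLetter : Letter → Letter
  afterLetter N = E
  afterLetter E = N

  can-after-N : ∀ l w → nth (can (N ∷ l ∷ w)) 1 ≡ afterLetter l
  can-after-N N w = refl
  can-after-N E w = can-E-zero w

  -- The index is the number of North steps up to and including `e`. So for `e` entering v_{r-1},
  -- position `r` of the canopy tells whether v_{r-1} is a leaf.
  can-after : ∀ u {e e′ v} → out e ≡ false →
              nth (can (map letter (u ++ e ∷ e′ ∷ v))) (suc (length (filterᵇ isDown u))) ≡ afterLetter (letter e′)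
  can-after [] {e} {e′} {v} o = trans (cong (λ l → nth (can (l ∷ letter e′ ∷ map letter v)) 1) (letter-N o)) (can-after-N (letter e′) (map letter v))
  can-after (d ∷ u) {e} {e′} {v} o = by-cases (out d) refl
    where
    w = map letter (u ++ e ∷ e′ ∷ v)
    by-cases : ∀ b → out d ≡ b →
               nth (can (letter d ∷ w)) (suc (length (filterᵇ isDown (d ∷ u)))) ≡ afterLetter (letter e′)
    by-cases true od = trans (cong₂ (λ l f → nth (can (l ∷ w)) (suc (length f))) (letter-E od) (filterᵇ-reject isDown (cong not od)))
      (trans (can-E-suc w (length (filterᵇ isDown u))) (can-after u o))
    by-cases false od = trans (cong₂ (λ l f → nth (can (l ∷ w)) (suc (length f))) (letter-N od) (filterᵇ-accept isDown (cong not od)))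
      (can-after u o)

  can-γ′ : can (γ' n) ≡ map canLetter (0 ∷ map inRed (drop 1 (visitDarts n)))
  can-γ′ = cong (map canLetter) (exponents-concat inRed (drop 1 (visitDarts n)))

  -- Dropping v_0 shifts the list by one, and the exponent 0 before the first North step shifts it
  -- back: position `r` reads v_r.
  can-γ′-later : ∀ u {y₀ y v} → visitDarts n ≡ u ++ y₀ ∷ y ∷ v → nth (can (γ' n)) (suc (length u)) ≡ canLetter (inRed y)
  can-γ′-later u {y₀} {y} {v} e with drop-first u {y₀} {y} {v}
  ... | u′ , e₁ , e₂ = begin
    nth (can (γ' n)) (suc (length u))                                       ≡⟨ cong (λ w → nth w (suc (length u))) can-γ′ ⟩
    nth (map canLetter (map inRed (drop 1 (visitDarts n)))) (length u)      ≡⟨ cong₂ (λ l → nth (map canLetter (map inRed l))) (trans (cong (drop 1) e) e₁) (sym e₂) ⟩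
    nth (map canLetter (map inRed (u′ ++ y ∷ v))) (length u′)               ≡⟨ nth-map-map inRed u′ ⟩
    canLetter (inRed y)                                                     ∎
    where open ≡-Reasoning

  TypeAt : Fin k → ℕ → Set
  TypeAt y r = BlackType y (positionType (γ n) (γ' n) r)

  contour-head : Σ (List (Fin k)) λ v → contour n ≡ c 0 ∷ v
  contour-head with applyUpTo-head c 0<2n
  ... | v , e = v , trans (contour≡ n) e

  c-0-down : out (c 0) ≡ false
  c-0-down = trans (cong out c-0≡) (cong proj₁ σσρ-lab)

  down-head : Σ (List (Fin k)) λ v → down ≡ c 0 ∷ v
  down-head with contour-head
  ... | v , e = filterᵇ isDown v , trans (cong (filterᵇ isDown) e) (filterᵇ-accept isDown (cong not c-0-down))

  -- v₀ is the first child of u_B: its face has the corner of u_G as green corner.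
  type-first : ∀ {y v} → visitDarts n ≡ y ∷ v → TypeAt y 0
  type-first {y} {v} e = inj₂ (inj₁ ((λ l → ¬oriented φy-inner φy-in (leg-red⁻ l)) ,
                                leg-green (subst Oriented (sym φφy) (inj₁ (inj₁ refl))) ,
                                cong₂ _,_ (cong (λ w → nth w 0) can-γ′) first-letter))
    where
    y≡ : y ≡ α (c 0)
    y≡ with down-head
    ... | w , ed = sym (proj₁ (∷-injective (trans (sym (cong (λ l → map α l ++ α ρ ∷ []) ed)) e)))
    y≡φσρ : y ≡ φ (σ ρ)
    y≡φσρ = trans y≡ (cong α c-0≡)
    -- This is the outer dart from u_B to u_G, oriented clockwise by convention; it makes the green
    -- edge a leg.
    φφy : φ (φ y) ≡ σ ρ
    φφy = trans (cong (λ z → φ (φ z)) y≡φσρ) (φ³ (σ ρ))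
    open Parent (visit⁻ (subst (y ∈_) (sym e) (here refl)))
    φy-inner : ¬ OuterDart (φ y)
    φy-inner = inner-α σy-inner
    φy-at-G : SameVertex dG (φ y)
    φy-at-G = vertex-sym (vertex-trans vertex-σ (subst (SameVertex (σ (φ y)))
      (trans (sym (α-invol (σ (φ y)))) (cong α φφy)) vertex-refl))
    φy-in : out (φ y) ≡ false
    φy-in = cong proj₁ (at-uG (φ y) φy-inner φy-at-G)
    first-letter : nth (can (γ n)) 0 ≡ E
    first-letter with contour-head
    ... | w , ec = trans (cong (λ x → nth (can (map letter x)) 0) ec)
                     (cong (λ l → nth (can (l ∷ map letter w)) 0) (letter-N c-0-down))

  -- The face to the right of the cycle y, φ (φ y), φ y is its interior.
  no-clockwise-face : ∀ {y} → ¬ OuterCorner y →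
    (¬ OuterDart y × out y ≡ true) → (¬ OuterDart (φ y) × out (φ y) ≡ true) →
    (¬ OuterDart (φ (φ y)) × out (φ (φ y)) ≡ true) → ⊥
  no-clockwise-face {y} ¬c o₀ o₁ o₂ = minimal 2 cyc (oriented , consecutive , closing , simple) enclosed
    where
    cyc : Fin 3 → Fin k
    cyc Fin.zero = y
    cyc (Fin.suc Fin.zero) = φ (φ y)
    cyc (Fin.suc (Fin.suc Fin.zero)) = φ y
    oriented : ∀ i → ¬ OuterDart (cyc i) × out (cyc i) ≡ true
    oriented Fin.zero = o₀
    oriented (Fin.suc Fin.zero) = o₂
    oriented (Fin.suc (Fin.suc Fin.zero)) = o₁
    φ-link : ∀ z → SameVertex (α (φ z)) z
    φ-link z = subst (λ w → SameVertex w z) (sym (α-invol (σ z))) (vertex-sym vertex-σ)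
    consecutive : ∀ i j → toℕ j ≡ suc (toℕ i) → SameVertex (α (cyc i)) (cyc j)
    consecutive Fin.zero (Fin.suc Fin.zero) _ = subst (λ w → SameVertex (α w) (φ (φ y))) (φ³ y) (φ-link (φ (φ y)))
    consecutive (Fin.suc Fin.zero) (Fin.suc (Fin.suc Fin.zero)) _ = φ-link (φ y)
    consecutive Fin.zero Fin.zero ()
    consecutive Fin.zero (Fin.suc (Fin.suc Fin.zero)) ()
    consecutive (Fin.suc Fin.zero) Fin.zero ()
    consecutive (Fin.suc Fin.zero) (Fin.suc Fin.zero) ()
    consecutive (Fin.suc (Fin.suc Fin.zero)) Fin.zero ()
    consecutive (Fin.suc (Fin.suc Fin.zero)) (Fin.suc Fin.zero) ()
    consecutive (Fin.suc (Fin.suc Fin.zero)) (Fin.suc (Fin.suc Fin.zero)) ()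
    closing : SameVertex (α (φ y)) y
    closing = φ-link y
    02≢ : ¬ SameVertex y (φ (φ y))
    02≢ s = vertex≢ (φ (φ y)) (subst (SameVertex (φ (φ y))) (sym (φ³ y)) (vertex-sym s))
    simple : ∀ i j → SameVertex (cyc i) (cyc j) → i ≡ j
    simple Fin.zero Fin.zero _ = refl
    simple Fin.zero (Fin.suc Fin.zero) s = ⊥-elim (02≢ s)
    simple Fin.zero (Fin.suc (Fin.suc Fin.zero)) s = ⊥-elim (vertex≢ y s)
    simple (Fin.suc Fin.zero) Fin.zero s = ⊥-elim (02≢ (vertex-sym s))
    simple (Fin.suc Fin.zero) (Fin.suc Fin.zero) _ = refl
    simple (Fin.suc Fin.zero) (Fin.suc (Fin.suc Fin.zero)) s = ⊥-elim (vertex≢ (φ y) (vertex-sym s))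
    simple (Fin.suc (Fin.suc Fin.zero)) Fin.zero s = ⊥-elim (vertex≢ y (vertex-sym s))
    simple (Fin.suc (Fin.suc Fin.zero)) (Fin.suc Fin.zero) s = ⊥-elim (vertex≢ (φ y) s)
    simple (Fin.suc (Fin.suc Fin.zero)) (Fin.suc (Fin.suc Fin.zero)) _ = refl
    on-cycle : ∀ {z} → Face y z → OnCycle cyc z
    on-cycle at₀ = Fin.zero , inj₁ refl
    on-cycle at₁ = Fin.suc (Fin.suc Fin.zero) , inj₁ refl
    on-cycle at₂ = Fin.suc Fin.zero , inj₁ refl
    -- All three darts of the face are on the cycle, so no edge can be crossed and only `φ` remains.
    stay : ∀ {z w} → Star (CornerStep cyc) z w → Face y z → Face y w
    stay ε f = f
    stay (inj₁ refl ◅ s) f = stay s (face⁻′ (face-trans (face f) (face at₁)))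
    stay (inj₂ (_ , ¬on) ◅ s) f = ⊥-elim (¬on (on-cycle f))
    enclosed : Clockwise cyc
    enclosed s = ¬c (face⁻′ (face-sym (face (stay s at₀))))

  -- First tree darts, and the positions after the first

  tree-blue : ∀ {z} → InnerVertex z → TreeDart z → col z ≡ blue
  tree-blue v (inj₁ (_ , c))  = c
  tree-blue v (inj₂ (inj₁ r)) = ⊥-elim (inner-vertex⇒inner v (subst OuterDart (sym r) (outer oB)))
  tree-blue v (inj₂ (inj₂ r)) = ⊥-elim (inner-vertex⇒inner v (subst OuterDart (sym r) outer-αρ))

  -- From the out-blue dart o of a vertex, the walk skips the ingoing red darts and the outgoing
  -- green dart x.
  first-after-red : ∀ {o} → InnerVertex o → Lab o ≡ (true , blue) → ∀ m {y} → cc (iter σ m o) ≡ red →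
                    FirstTree (σ (iter σ m o)) y → FirstTree (σ o) y
  first-after-red v l zero e f = f
  first-after-red {o} v l (suc m) {y} e f = by-lab (cornerAfter-red (Lab z) (trans (sym (cc-inner-vertex z-inner)) e))
    where
    z = iter σ (suc m) o
    z-inner : InnerVertex z
    z-inner = inner-vertex-resp (vertex (suc m , refl)) v
    by-follows : Lab z ≡ (false , red) → Lab z ≡ (false , cc (iter σ m o)) ⊎ Lab z ≡ (true , next (cc (iter σ m o))) → FirstTree (σ o) y
    by-follows e′ (inj₁ e″) = first-after-red v l m (sym (cong proj₂ (trans (sym e′) e″)))
      (first-later (λ u → not-red (tree-blue z-inner u)) f)
      where
      not-red : col z ≢ blue
      not-red b with () ← trans (sym b) (cong proj₂ e′)
    by-follows e′ (inj₂ e″) with () ← trans (sym e′) e″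
    by-lab : Lab z ≡ (false , red) ⊎ Lab z ≡ (true , blue) → FirstTree (σ o) y
    by-lab (inj₁ e′) = by-follows e′ (follows-cc (iter σ m o) (inner-vertex⇒inner z-inner))
    by-lab (inj₂ e′) = subst (λ w → FirstTree (σ w) y) (sym (out-blue-unique v (suc m , refl) l e′)) f

  first-after-green : ∀ {o x} → InnerVertex o → Lab o ≡ (true , blue) → Reaches σ o x → Lab x ≡ (true , green) →
                      TreeDart (σ x) → FirstTree (σ o) (σ x)
  first-after-green v l (zero , refl) g t with () ← trans (sym l) g
  first-after-green {o} {x} v l (suc m , refl) g u = by-follows (follows-cc (iter σ m o) (inner-vertex⇒inner x-inner))
    where
    x-inner : InnerVertex x
    x-inner = inner-vertex-resp (vertex (suc m , refl)) v
    next-green : ∀ d → next d ≡ green → d ≡ red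
    next-green red _ = refl
    by-follows : Lab x ≡ (false , cc (iter σ m o)) ⊎ Lab x ≡ (true , next (cc (iter σ m o))) → FirstTree (σ o) (σ x)
    by-follows (inj₁ e) with () ← trans (sym g) e
    by-follows (inj₂ e) = first-after-red v l m (next-green _ (sym (cong proj₂ (trans (sym g) e))))
      (first-later (λ w → green≢ (tree-blue x-inner w)) (first-here u))
      where green≢ : col x ≢ blue
            green≢ b with () ← trans (sym b) (cong proj₂ g)

  -- Here `r` is `suc (length u)`: `y` leads from v_r to its parent, `e₀` is the contour step into
  -- v_{r-1}, and `τ e₀` is the next step, upward iff v_{r-1} is a leaf.
  module Later {y₀ y : Fin k} {u v : List (Fin k)} (e : visitDarts n ≡ u ++ y₀ ∷ y ∷ v)
    {e₀ : Fin k} {u₁ v₁ : List (Fin k)} (down≡ : down ≡ u₁ ++ e₀ ∷ v₁)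
    (u₁-length : length u₁ ≡ length u) (rest : y ∷ v ≡ map α v₁ ++ α ρ ∷ [])
    {u₂ v₂ : List (Fin k)} (contour-split : contour n ≡ u₂ ++ e₀ ∷ τ e₀ ∷ v₂)
    (u₂-down : filterᵇ isDown u₂ ≡ u₁) (v₂-down : filterᵇ isDown (τ e₀ ∷ v₂) ≡ v₁) where

    par : ToParent y
    par = visit⁻ (subst (y ∈_) (sym e) (∈-++⁺ʳ u (there (here refl))))

    open Parent par

    e₀-down : Blue e₀ × out e₀ ≡ false
    e₀-down = ∈-down⁻ (subst (e₀ ∈_) (sym down≡) (∈-++⁺ʳ u₁ (here refl)))

    o x e′ : Fin k
    o  = α e₀
    x  = φ (φ y)
    e′ = τ e₀

    o-inner : InnerVertex o
    o-inner = out⇒inner-vertex (inner-α (proj₁ (proj₁ e₀-down))) (proj₂ (blue-α (proj₁ e₀-down) (proj₂ e₀-down)))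

    o-lab : Lab o ≡ (true , blue)
    o-lab = Lab-α (proj₁ (proj₁ e₀-down)) (cong₂ _,_ (proj₂ e₀-down) (proj₂ (proj₁ e₀-down)))

    e′-first : FirstTree (σ o) e′
    e′-first = tree-τ (inj₁ (proj₁ e₀-down))

    position-type : positionType (γ n) (γ' n) (suc (length u)) ≡ (canLetter (inRed y) , afterLetter (letter e′))
    position-type = cong₂ _,_ (can-γ′-later u e) (begin
      nth (can (γ n)) (suc (length u))
        ≡⟨ cong₂ (λ w l → nth (can (map letter w)) (suc l)) contour-split (sym (trans (cong length u₂-down) u₁-length)) ⟩
      nth (can (map letter (u₂ ++ e₀ ∷ e′ ∷ v₂))) (suc (length (filterᵇ isDown u₂)))
        ≡⟨ can-after u₂ (proj₂ e₀-down) ⟩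
      afterLetter (letter e′) ∎)
      where open ≡-Reasoning

    oriented-φy : Lab (σ y) ≡ (false , red) → ¬ OuterDart (φ y) × out (φ y) ≡ true
    oriented-φy l = inner-α σy-inner , cong proj₁ (Lab-α σy-inner l)

    ¬leg-red : Lab (σ y) ≡ (true , green) → ¬ LegAt y red
    ¬leg-red l leg = ¬oriented (inner-α σy-inner) (cong proj₁ (Lab-α σy-inner l)) (leg-red⁻ leg)

    next-down : y ≢ α ρ → Σ (List (Fin k)) λ w → v₁ ≡ α y ∷ w
    next-down ne = go v₁ rest
      where
      go : ∀ w → y ∷ v ≡ map α w ++ α ρ ∷ [] → Σ (List (Fin k)) λ w′ → w ≡ α y ∷ w′
      go []      r = ⊥-elim (ne (proj₁ (∷-injective r)))
      go (d ∷ w) r = w , cong (_∷ w) (trans (sym (α-invol d)) (cong α (sym (proj₁ (∷-injective r)))))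

    -- If v_{r-1} is a leaf of T_blue, then v_r is not a first child.
    module Leaf (up : out e′ ≡ true) where

      type : ∀ {d} → canLetter (inRed y) ≡ d → positionType (γ n) (γ' n) (suc (length u)) ≡ (d , N)
      type eq = trans position-type (cong₂ _,_ eq (cong afterLetter (letter-E up)))

      module _ (y-vertex : InnerVertex y) where

        y≢αρ : y ≢ α ρ
        y≢αρ r = inner-vertex⇒inner y-vertex (subst OuterDart (sym r) outer-αρ)

        y-blue : Blue y × out y ≡ true
        y-blue with par
        ... | inj₁ r = ⊥-elim (y≢αρ r)
        ... | inj₂ b = b

        αy-blue : Blue (α y) × out (α y) ≡ false
        αy-blue = blue-α (proj₁ y-blue) (proj₂ y-blue)

        down-split : Σ (List (Fin k)) λ w → down ≡ u₁ ++ e₀ ∷ α y ∷ w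
        down-split with next-down y≢αρ
        ... | w , r = w , trans down≡ (cong (λ l → u₁ ++ e₀ ∷ l) r)

        -- Otherwise the steps `α o′` and `α y` would be consecutive in the contour, hence in
        -- `down`. As `down` has no repetition, `α o′` would be `e₀`, and the upward step `e′` would
        -- be the downward step `α y`.
        not-after : ∀ {o′} → Blue o′ × out o′ ≡ true → ¬ FirstTree (σ o′) (α y)
        not-after {o′} (b , ob) f with c-index (proj₁ (blue-α b ob))
        ... | j , lt , ej with m≤n⇒m<n∨m≡n lt
        -- After the last step of the contour comes `ρ`, which is outer, whereas `α y` is inner.
        ...   | inj₂ eq = proj₁ (proj₁ αy-blue) (subst OuterDart (trans (sym c-last) (trans (cong c (sym eq)) τj)) (outer oB))
          where τj : c (suc j) ≡ α y
                τj = trans (cong τ ej) (trans (τ-def (α o′)) (trans (cong (λ z → firstTree (σ z)) (α-invol o′)) (first-tree≡ f)))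
        ...   | inj₁ lt′ with applyUpTo-split c lt′ | down-split
        ...     | a , b′ , ea | w , ed = case-true (trans (sym up) (trans (cong out e′≡) (proj₂ αy-blue)))
          where
          case-true : true ≢ false
          case-true ()
          τj : c (suc j) ≡ α y
          τj = trans (cong τ ej) (trans (τ-def (α o′)) (trans (cong (λ z → firstTree (σ z)) (α-invol o′)) (first-tree≡ f)))
          down≡′ : down ≡ filterᵇ isDown a ++ α o′ ∷ α y ∷ filterᵇ isDown b′
          down≡′ = begin
            filterᵇ isDown (contour n)                              ≡⟨ cong (filterᵇ isDown) (trans (contour≡ n) ea) ⟩
            filterᵇ isDown (a ++ c j ∷ c (suc j) ∷ b′)              ≡⟨ cong₂ (λ p q → filterᵇ isDown (a ++ p ∷ q ∷ b′)) ej τj ⟩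
            filterᵇ isDown (a ++ α o′ ∷ α y ∷ b′)                   ≡⟨ filterᵇ-++ isDown a _ ⟩
            filterᵇ isDown a ++ filterᵇ isDown (α o′ ∷ α y ∷ b′)
              ≡⟨ cong (filterᵇ isDown a ++_) (trans (filterᵇ-accept isDown (cong not (proj₂ (blue-α b ob))))
                   (cong (α o′ ∷_) (filterᵇ-accept isDown (cong not (proj₂ αy-blue))))) ⟩
            filterᵇ isDown a ++ α o′ ∷ α y ∷ filterᵇ isDown b′      ∎
            where open ≡-Reasoning
          e′≡ : e′ ≡ α y
          e′≡ = trans (cong τ (trans (unique-predecessor down-unique u₁ (filterᵇ isDown a) ed down≡′) (sym ej))) τj

        -- The dart `x` before `α y` would be oriented. If it is outgoing green, v_r is the first
        -- child of an inner vertex, against `not-after`. If it is the outer dart from u_B, `α y`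
        -- heads `down`, although `e₀` precedes it there. The other outer tails have no blue corner.
        ¬leg-green : ¬ LegAt y green
        ¬leg-green leg = by-cases (leg-green⁻ leg)
          where
          by-lab : ¬ OuterDart x → out x ≡ true → Lab x ≡ (false , blue) ⊎ Lab x ≡ (true , green) → ⊥
          by-lab ¬ox ox (inj₁ l) with () ← trans (sym ox) (cong proj₁ l)
          by-lab ¬ox ox (inj₂ l) with out-blue (out⇒inner-vertex ¬ox ox)
          ... | o′ , s , l′ = not-after ((inner-vertex⇒inner o′-inner , cong proj₂ l′) , cong proj₁ l′)
                  (subst (FirstTree (σ o′)) before-φφy
                    (first-after-green o′-inner l′ (vertex⁻ (vertex-sym s)) l
                      (subst TreeDart (sym before-φφy) (inj₁ (proj₁ αy-blue)))))
            where o′-inner : InnerVertex o′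
                  o′-inner = inner-vertex-resp s (out⇒inner-vertex ¬ox ox)
          by-cases : Oriented x → ⊥
          by-cases (inj₂ (¬ox , ox)) = by-lab ¬ox ox (cornerAfter-blue (Lab x) (trans (sym (cc-inner ¬ox)) cc-φφy))
          by-cases (inj₁ (inj₁ x≡)) with down-head | down-split
          ... | w , ed | w′ , ed′ = unique-first (subst Unique (trans ed (cong (_∷ w) c0≡)) down-unique) u₁
                  (trans (sym (trans ed (cong (_∷ w) c0≡))) ed′)
            where c0≡ : c 0 ≡ α y
                  c0≡ = trans c-0≡ (trans (cong σ (sym x≡)) before-φφy)
          by-cases (inj₁ (inj₂ (inj₁ x≡))) with () ← trans (sym cc-φφy) (cc-G (subst (SameVertex dG) (sym x≡) vertex-σ))
          by-cases (inj₁ (inj₂ (inj₂ x≡))) with () ← trans (sym cc-φφy) (cc-R (subst (SameVertex dR) (sym x≡) vertex-σ))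

      type-later : RedCase y → TypeAt y (suc (length u))
      type-later (some l eq)   = inj₁ (leg-red (inj₂ (oriented-φy l)) , type eq)
      type-later (none iv l eq) = inj₂ (inj₂ (¬leg-red l , ¬leg-green iv , type eq))

    -- Otherwise v_r is the first child of v_{r-1}, and an ingoing red edge at v_r would close a
    -- clockwise cycle.
    module Node (dn : out e′ ≡ false) where

      type : ∀ {d} → canLetter (inRed y) ≡ d → positionType (γ n) (γ' n) (suc (length u)) ≡ (d , E)
      type eq = trans position-type (cong₂ _,_ eq (cong afterLetter (letter-N dn)))

      e′-vertex : InnerVertex e′
      e′-vertex = inner-vertex-resp (vertex-trans vertex-σ (first-vertex e′-first)) o-inner

      y≡ : y ≡ α e′
      y≡ = proj₁ (∷-injective (trans rest (cong (λ l → map α l ++ α ρ ∷ []) (trans (sym v₂-down) (filterᵇ-accept isDown (cong not dn))))))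

      σx : σ x ≡ e′
      σx = trans before-φφy (trans (cong α y≡) (α-invol e′))

      x-vertex : InnerVertex x
      x-vertex = inner-vertex-resp (vertex-sym (subst (SameVertex x) σx vertex-σ)) e′-vertex

      -- An ingoing blue `x` would be a tree dart met before the first one, `e′`, or would be `o`
      -- itself, which is outgoing.
      x-lab : Lab x ≡ (true , green)
      x-lab = by-lab (cornerAfter-blue (Lab x) (trans (sym (cc-inner-vertex x-vertex)) cc-φφy)) e′-first
        where
        by-lab : Lab x ≡ (false , blue) ⊎ Lab x ≡ (true , green) → FirstTree (σ o) e′ → Lab x ≡ (true , green)
        by-lab (inj₂ l) _ = l
        by-lab (inj₁ l) (zero , ej , _) with () ← trans (sym l) (trans (cong Lab (σ-perm (trans σx (sym ej)))) o-lab)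
        by-lab (inj₁ l) (suc j , ej , _ , before) =
          ⊥-elim (before j ≤-refl (subst TreeDart (sym (σ-perm (trans ej (sym σx)))) (inj₁ (inner-vertex⇒inner x-vertex , cong proj₂ l))))

      y-oriented : ¬ OuterDart y × out y ≡ true
      y-oriented = subst (λ z → ¬ OuterDart z × out z ≡ true) (sym y≡)
        (inner-α e′-inner , proj₂ (blue-α (e′-inner , tree-blue e′-vertex (first-tree e′-first)) dn))
        where e′-inner = inner-vertex⇒inner e′-vertex

      x-oriented : ¬ OuterDart x × out x ≡ true
      x-oriented = inner-vertex⇒inner x-vertex , cong proj₁ x-lab

      type-later : RedCase y → TypeAt y (suc (length u))
      type-later (some l _)    = ⊥-elim (no-clockwise-face y-inner y-oriented (oriented-φy l) x-oriented)
      type-later (none _ l eq) = inj₂ (inj₁ (¬leg-red l , leg-green (inj₂ x-oriented) , type eq))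

    type-later : TypeAt y (suc (length u))
    type-later = by-cases (out e′) refl
      where
      by-cases : ∀ b → out e′ ≡ b → TypeAt y (suc (length u))
      by-cases true  up = Leaf.type-later up (red-case par)
      by-cases false dn = Node.type-later dn (red-case par)

  -- A downward step is never the last of the contour: the last one ends at u_B, a downward one at
  -- an inner vertex.
  next-step : ∀ u {e₀ v} → contour n ≡ u ++ e₀ ∷ v → Blue e₀ × out e₀ ≡ false →
              Σ (List (Fin k)) λ v′ → v ≡ τ e₀ ∷ v′
  next-step u {e₀} e (b , ob) with split-applyUpTo c (2 * n) u (trans (sym (contour≡ n)) e)
  ... | e₀≡ , inj₂ (v′ , ev) = v′ , trans ev (cong (λ z → τ z ∷ v′) (sym e₀≡))
  ... | e₀≡ , inj₁ eq = ⊥-elim (proj₁ (out⇒inner-vertex (inner-α (proj₁ b)) (proj₂ (blue-α b ob))) at-B)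
    where
    τ≡ρ : τ e₀ ≡ ρ
    τ≡ρ = trans (cong τ e₀≡) (trans (cong c (sym eq)) c-last)
    at-B : SameVertex (α e₀) dB
    at-B = subst (SameVertex (α e₀)) τ≡ρ (vertex-trans vertex-σ (first-vertex (tree-τ (inj₁ b))))

  type-later : ∀ u {y₀ y v} → visitDarts n ≡ u ++ y₀ ∷ y ∷ v → TypeAt y (suc (length u))
  type-later u e with split-map-snoc α down u e
  ... | u₁ , e₀ , v₁ , down≡ , _ , len , rest with split-filterᵇ isDown (contour n) down≡
  ...   | u₂ , v₂ , ec , f₁ , f₂ , _ with next-step u₂ ec (∈-down⁻ (subst (e₀ ∈_) (sym down≡) (∈-++⁺ʳ u₁ (here refl))))
  ...     | v₃ , refl = Later.type-later {u = u} e {u₁ = u₁} down≡ len rest {u₂ = u₂} ec f₁ f₂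

  type-at : ∀ u {y v} → visitDarts n ≡ u ++ y ∷ v → TypeAt y (length u)
  type-at u e with initLast u
  ... | []      = type-first e
  ... | u′ ∷ʳ′ y₀ = subst (TypeAt _) (sym (trans (length-++ u′) (+-comm (length u′) 1)))
                      (type-later u′ (trans e (++-assoc u′ (y₀ ∷ []) _)))

  -- The bijection from positions to black nodes

  index-of : Fin (suc n) → Fin (length (visitDarts n))
  index-of = cast (sym visit-length)

  g : Fin (suc n) → Fin k
  g r = lookup (visitDarts n) (index-of r)

  g-parent : ∀ r → ToParent (g r)
  g-parent r = visit⁻ (∈-lookup (index-of r))

  g-type : ∀ r → TypeAt (g r) (toℕ r)
  g-type r = subst (TypeAt (g r)) (toℕ-cast (sym visit-length) r)
               (lookup-from-split TypeAt (visitDarts n) type-at (index-of r))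

  -- Each `g r` is the only red corner of its face.
  g-injective : ∀ r r′ → SameFace (g r) (g r′) → r ≡ r′
  g-injective r r′ s = toℕ-injective (begin
    toℕ r             ≡⟨ sym (toℕ-cast (sym visit-length) r) ⟩
    toℕ (index-of r)  ≡⟨ cong toℕ (lookup-injective visit-unique (index-of r) (index-of r′) same) ⟩
    toℕ (index-of r′) ≡⟨ toℕ-cast (sym visit-length) r′ ⟩
    toℕ r′            ∎)
    where
    open ≡-Reasoning
    same : g r ≡ g r′
    same = same-colour (Parent.y-inner (g-parent r)) (face⁻′ s)
             (trans (Parent.cc-y (g-parent r)) (sym (Parent.cc-y (g-parent r′))))

  -- Among outgoing inner darts only blue ones open a red corner, and among the outer tails only the
  -- one at u_R has a red corner.
  leg-to-parent : ∀ {y} → cc y ≡ red → Oriented y → ToParent y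
  leg-to-parent e (inj₁ (inj₁ refl)) with () ← trans (sym e) (cc-B vertex-σ)
  leg-to-parent e (inj₁ (inj₂ (inj₁ refl))) with () ← trans (sym e) (cc-G vertex-σ)
  leg-to-parent e (inj₁ (inj₂ (inj₂ refl))) = inj₁ (sym α-dB)
  leg-to-parent {y} e (inj₂ (¬o , oy)) = inj₂ ((¬o , blue-of (col y) next-red) , oy)
    where
    next-red : next (col y) ≡ red
    next-red = trans (sym (cong (λ b → cornerAfter (b , col y)) oy)) (trans (sym (cc-inner ¬o)) e)
    blue-of : ∀ d → next d ≡ red → d ≡ blue
    blue-of blue _ = refl

  -- The leg at the blue corner `x` comes from the oriented dart `φ x`, whose corner has colour
  -- `next blue`, that is, red.
  visit-of-leg : ∀ {f} → InnerFace f → LegAt f blue → Σ (Fin k) λ y → y ∈ visitDarts n × SameFace y f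
  visit-of-leg ¬outer l with leg⁻ l
  ... | x , s , e , o = φ x
      , visit (leg-to-parent (trans (cc-φ λ oc → ¬outer (face-trans (face oc) s)) (cong next e)) o)
      , face-trans (face-sym (face at₁)) s

  g-surjective : ∀ f → InnerFace f → LegAt f blue → Σ (Fin (suc n)) λ r → SameFace (g r) f
  g-surjective f ¬outer l =
    let (y , y∈ , s) = visit-of-leg ¬outer l
        (r , r≡)     = ∈⇒lookup-cast visit-length y∈
    in r , subst (λ z → SameFace z f) (sym r≡) s

  bijection : TypeBijection n
  bijection = g , (λ r → (λ s → Parent.y-inner (g-parent r) (face⁻′ s)) , Parent.leg-blue (g-parent r) , g-type r)
            , g-injective , g-surjective

theorem2 : (n k : ℕ) → 1 ≤ n → (M : Map k) → IsRootedTriangulation M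
    → MapOps.numVertices M ≡ n + 3
    → (W : Wood k) → WoodOps.IsSchnyderWood M W → WoodOps.IsMinimal M W
    → WoodOps.TypeBijection M W n
theorem2 n k 1≤n M tri card W wood minimal = Positions.bijection M tri W wood n 1≤n card minimal
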